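{- Let $m$ be even and $\mathbb M=\mathbb F_{2^m}$. Every Carlet function on $\mathbb M\times\mathbb M$ is EA-equivalent to a Zhou-Pott function on $\mathbb M\times\mathbb M$.
   Context: For $q=2^k$ write $(a,b,c,d)_q=ax^{q+1}+bx^qy+cxy^q+dy^{q+1}$, $a,b,c,d\in\mathbb M$. Carlet functions: $(x,y)\mapsto(xy,(1,b,c,d)_q)$ with $q=2^k$, $0<k<m$, $\gcd(k,m)=1$, $b,c,d\in\mathbb M$ and $x^{q+1}+bx^q+cx+d\ne0$ for all $x\in\mathbb M$. Zhou-Pott functions ($m$ even): $(x,y)\mapsto((1,0,0,d)_q,(0,0,1,0)_r)=(x^{q+1}+dy^{q+1},xy^r)$ with $q=2^k$, $0<k<m$, $\gcd(k,m)=1$, $r=2^j$, $0\le j<m$, $d\in\mathbb M$ and $d\ne a^{q+1}(b^q+b)^{1-r}$ for all $a\in\mathbb M$ and all $b\in\mathbb M$ with $b^q+b\neq0$. With $V=\mathbb M\times\mathbb M$ and $\Gamma_F=\{(z,F(z)):z\in V\}$, functions $F,G:V\to V$ are EA-equivalent if there is an affine permutation $\mathcal A:(x,y)\mapsto\begin{pmatrix} M & 0 \\ N & L \end{pmatrix}\begin{pmatrix} x \\ y \end{pmatrix}+\begin{pmatrix} u \\ v \end{pmatrix}$ of $V\times V$ ($M,N,L$ being $\mathbb F_2$-linear maps of $V$, $u,v\in V$) with $\mathcal A(\Gamma_F)=\Gamma_G$. -}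

module Defs where

open import Algebra.Bundles using (CommutativeRing)
open import Algebra.Module.Bundles.Raw using (RawLeftModule)
open import Algebra.Module.Construct.DirectProduct using (rawLeftModule)
open import Algebra.Module.Morphism.Structures using (module LeftModuleMorphisms)
import Algebra.Definitions
import Algebra.Properties.Semiring.Exp
open import Data.Bool.Base using (Bool; if_then_else_)
open import Data.Fin.Base using (Fin)
open import Data.Integer.Base as ℤ using (ℤ; +_; -[1+_]; 1ℤ)
open import Data.Nat.Base as ℕ using (ℕ; suc)
open import Data.Nat.Divisibility using (_∣_)
open import Data.Nat.GCD using (gcd)
open import Data.Product.Base using (_×_; _,_; proj₁; ∃)
open import Data.Product.Relation.Binary.Pointwise.NonDependent using (Pointwise)
open import Function.Bundles using (Inverse)
open import Function.Definitions using (Bijective)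
open import Level using (Level; _⊔_) renaming (suc to lsuc)
open import Relation.Binary.Core using (Rel)
open import Relation.Binary.PropositionalEquality as ≡ using (_≡_)
open import Relation.Nullary.Negation using (¬_)
open import Relation.Unary using (Pred; _∈_; _≐_)

record FiniteField (κ ℓ : Level) (size : ℕ) : Set (lsuc (κ ⊔ ℓ)) where
  field
    commutativeRing : CommutativeRing κ ℓ

  open CommutativeRing commutativeRing public
  open Algebra.Definitions _≈_ using (Invertible)

  field
    0≉1         : ¬ (0# ≈ 1#)
    invertible  : ∀ x → ¬ (x ≈ 0#) → Invertible 1# _*_ x
    enumeration : Inverse setoid (≡.setoid (Fin size))

  inverse : ∀ x → ¬ (x ≈ 0#) → Carrier
  inverse x x≉0 = proj₁ (invertible x x≉0)

module Functions {κ ℓ : Level} {m : ℕ} (𝕄 : FiniteField κ ℓ (2 ℕ.^ m)) where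

  open FiniteField 𝕄
  open Algebra.Properties.Semiring.Exp semiring using (_^_)

  zpow : ∀ x → ¬ (x ≈ 0#) → ℤ → Carrier
  zpow x x≉0 (+ n)    = x ^ n
  zpow x x≉0 -[1+ n ] = inverse x x≉0 ^ suc n

  -- 𝔽₂ is Bool, with xor as addition and ∧ as multiplication.  Linearity of a
  -- map only refers to the operations, so the raw module suffices.
  𝕄-over-𝔽₂ : RawLeftModule Bool κ ℓ
  𝕄-over-𝔽₂ = record
    { Carrierᴹ = Carrier
    ; _≈ᴹ_     = _≈_
    ; _+ᴹ_     = _+_
    ; _*ₗ_     = λ s x → if s then x else 0#
    ; 0ᴹ       = 0#
    ; -ᴹ_      = -_
    }

  V-over-𝔽₂ : RawLeftModule Bool κ ℓ
  V-over-𝔽₂ = rawLeftModule 𝕄-over-𝔽₂ 𝕄-over-𝔽₂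

  open RawLeftModule V-over-𝔽₂ public
    using () renaming (Carrierᴹ to V; _≈ᴹ_ to _≈ⱽ_; _+ᴹ_ to _+ⱽ_)
  open LeftModuleMorphisms V-over-𝔽₂ V-over-𝔽₂ public
    using () renaming (IsLeftModuleHomomorphism to 𝔽₂-Linear)

  infix 4 _≈²_
  _≈²_ : Rel (V × V) ℓ
  _≈²_ = Pointwise _≈ⱽ_ _≈ⱽ_

  Graph : (V → V) → Pred (V × V) (κ ⊔ ℓ)
  Graph F p = ∃ λ z → p ≈² (z , F z)

  Image : (V × V → V × V) → Pred (V × V) (κ ⊔ ℓ) → Pred (V × V) (κ ⊔ ℓ)
  Image 𝒜 S q = ∃ λ p → p ∈ S × 𝒜 p ≈² q

  record EAEquivalent (F G : V → V) : Set (κ ⊔ ℓ) where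
    field
      M N L    : V → V
      M-linear : 𝔽₂-Linear M
      N-linear : 𝔽₂-Linear N
      L-linear : 𝔽₂-Linear L
      u v      : V

    𝒜 : V × V → V × V
    𝒜 (x , y) = (M x +ⱽ u) , ((N x +ⱽ L y) +ⱽ v)

    field
      permutation : Bijective _≈²_ _≈²_ 𝒜
      maps-graph  : Image 𝒜 (Graph F) ≐ Graph G

  form : (a b c d : Carrier) (q : ℕ) → V → Carrier
  form a b c d q (x , y) =
    a * x ^ suc q + b * (x ^ q * y) + c * (x * y ^ q) + d * y ^ suc q

  record Carlet : Set (κ ⊔ ℓ) where
    field
      k       : ℕ
      0<k     : 0 ℕ.< k
      k<m     : k ℕ.< m
      coprime : gcd k m ≡ 1
      b c d   : Carrier

    q : ℕ
    q = 2 ℕ.^ k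

    field
      rootless : ∀ x → ¬ (x ^ suc q + b * x ^ q + c * x + d ≈ 0#)

    function : V → V
    function (x , y) = x * y , form 1# b c d q (x , y)

  record ZhouPott : Set (κ ⊔ ℓ) where
    field
      m-even  : 2 ∣ m
      k       : ℕ
      0<k     : 0 ℕ.< k
      k<m     : k ℕ.< m
      coprime : gcd k m ≡ 1
      j       : ℕ
      j<m     : j ℕ.< m
      d       : Carrier

    q : ℕ
    q = 2 ℕ.^ k

    r : ℕ
    r = 2 ℕ.^ j

    field
      d-avoids : ∀ a b (b^q+b≉0 : ¬ (b ^ q + b ≈ 0#)) →
                 ¬ (d ≈ a ^ suc q * zpow (b ^ q + b) b^q+b≉0 (1ℤ ℤ.- + r))

    function : V → V
    function z = form 1# 0# 0# d q z , form 0# 0# 1# 0# r z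

{-# OPTIONS --safe #-}

-- Write the second component of the Carlet function as f(v) = [φ v , v] with
-- [ , ] the determinant and φ a q-semilinear map of 𝕄²; rootlessness says that
-- φ has no eigenline.  T = φᵐ is linear and commutes with φ, so its trace and
-- determinant are fixed by x ↦ x^q and lie in 𝔽₂.  By Hilbert 90 a nonzero
-- vector fixed by T would yield one fixed by φ, so the characteristic
-- polynomial of T is X² + X + 1.  As m is even, its roots ω and ω + 1 lie in 𝕄,
-- and φ interchanges the two eigenlines of T.  If v spans one of them and
-- w = φ v the other, then f(X v + Y w) = f(v) X^(q+1) + f(w) Y^(q+1), while the
-- product of the coordinates of X v + Y w is [v , w] X Y plus a combination of
-- the 𝔽₂-linear maps X², Y².  This is a Zhou-Pott function with r = 1.
module Submission where

open import Defs
open import Algebra.Bundles using (CommutativeMonoid; CommutativeRing)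
open import Algebra.Module.Morphism.Structures using (module LeftModuleMorphisms)
import Algebra.Properties.CommutativeMonoid.Sum
import Algebra.Properties.CommutativeSemiring.Exp
import Algebra.Properties.Ring
import Algebra.Properties.Semiring.Exp
import Algebra.Properties.Semiring.Mult
import Algebra.Solver.Ring
open import Algebra.Solver.Ring.AlmostCommutativeRing using (fromCommutativeRing; _-Raw-AlmostCommutative⟶_)
open import Data.Bool.Base using (Bool; true; false; _xor_; _∧_)
open import Data.Bool.Properties using (xor-∧-commutativeRing)
open import Data.Fin.Base as Fin using (Fin; zero; suc; inject≤)
open import Data.Fin.Permutation using (permutation)
import Data.Fin.Properties as Fin
open import Data.Maybe.Base using (Maybe; just; nothing)
open import Data.Nat.Base as ℕ using (ℕ; zero; suc; z≤n; s≤s)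
open import Data.Nat.Coprimality as Coprime using (coprime-divisor; gcd≡1⇒coprime)
open import Data.Nat.DivMod using (_%_; _/_; m%n<n; m≡m%n+[m/n]*n)
open import Data.Nat.Divisibility using (_∣_; divides; ∣⇒≤; m%n≡0⇒n∣m)
open import Data.Nat.GCD using (gcd; GCD; gcd-GCD; module Bézout)
import Data.Nat.Properties as ℕ
open import Data.Nat.Solver using (module +-*-Solver)
open import Data.Product using (∃; _×_; _,_; proj₁; proj₂)
open import Data.Product.Relation.Binary.Pointwise.NonDependent using (×-setoid)
open import Data.Sum using (_⊎_; inj₁; inj₂; [_,_]′)
open import Data.Vec.Base using (Vec; []; _∷_; replicate)
open import Function.Base using (_∘_; id)
open import Function.Bundles using (Inverse)
open import Level using (Level)
open import Relation.Binary.Bundles using (Setoid)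
open import Relation.Binary.Definitions using (Decidable)
open import Relation.Binary.PropositionalEquality as ≡ using (_≡_)
import Relation.Binary.Reasoning.Setoid as SetoidReasoning
open import Relation.Nullary using (¬_; yes; no; contradiction)
open import Relation.Nullary.Decidable using (map′; ¬?)

-- A basis v, w makes the form diagonal exactly when [φ v , w] and [φ w , v] vanish, that is, when φ
-- carries each of the two lines into the other. So a line is sought that φ moves and φ² returns to
-- itself. As φ² is in general only semilinear, a characteristic polynomial does not find such a
-- line; φᵐ is linear because σᵐ is the identity, and φ permutes its eigenlines because the two maps
-- commute. The polynomial X² + X + 1 arises by elimination: eigenvalue 0 contradicts injectivity of
-- φ, eigenvalue 1 gives a fixed vector, and no other monic quadratic over 𝔽₂ is without roots.
-- Coprimality of k and m enters twice: the fixed field of σ is 𝔽₂, which also forces σ ω ≠ ω, and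
-- the powers σⁱ with i < m are distinct, which Hilbert 90 needs. For r = 1 the Zhou-Pott condition
-- asks that the new coefficient be no (q+1)-th power; otherwise the diagonal form would have a
-- nontrivial zero.

-- Finite fields: decidability, folds over all elements, Fermat's theorem.

module FiniteFieldProperties {κ ℓ : Level} {size : ℕ} (𝕄 : FiniteField κ ℓ size) where

  open FiniteField 𝕄 hiding (zero)
  open Algebra.Properties.Semiring.Exp semiring renaming (_^_ to infixr 8 _^_)
  open Algebra.Properties.Ring ring using (+-cancelˡ)
  open Inverse enumeration public using ()
    renaming (to to index; from to element; from-cong to element-cong; to-cong to index-cong;
              strictlyInverseˡ to index-element; strictlyInverseʳ to element-index)
  open import Relation.Binary.Reasoning.Setoid setoid

  index-injective : ∀ {x y} → index x ≡ index y → x ≈ y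
  index-injective {x} {y} eq = begin
    x                   ≈⟨ element-index x ⟨
    element (index x)   ≈⟨ element-cong eq ⟩
    element (index y)   ≈⟨ element-index y ⟩
    y                   ∎

  element-injective : ∀ {i j} → element i ≈ element j → i ≡ j
  element-injective {i} {j} eq =
    ≡.trans (≡.sym (index-element i)) (≡.trans (index-cong eq) (index-element j))

  infix 4 _≟_
  _≟_ : Decidable _≈_
  x ≟ y = map′ index-injective index-cong (index x Fin.≟ index y)

  -- A finite search through the enumeration decides the alternative, so the counting arguments
  -- below yield explicit witnesses.
  fixed-or-moved : (f : Carrier → Carrier) → (∀ {x y} → x ≈ y → f x ≈ f y) →
                   (∀ x → f x ≈ x) ⊎ ∃ λ x → ¬ (f x ≈ x)
  fixed-or-moved f f-cong with Fin.any? (λ i → ¬? (f (element i) ≟ element i))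
  ... | yes (i , moved) = inj₂ (element i , moved)
  ... | no  none        = inj₁ λ x → begin
    f x                     ≈⟨ f-cong (element-index x) ⟨
    f (element (index x))   ≈⟨ fixed (index x) ⟩
    element (index x)       ≈⟨ element-index x ⟩
    x                       ∎
    where
    fixed : ∀ i → f (element i) ≈ element i
    fixed i with f (element i) ≟ element i
    ... | yes eq = eq
    ... | no neq = contradiction (i , neq) none

  inverseˡ : ∀ {x} (x≉0 : ¬ (x ≈ 0#)) → inverse x x≉0 * x ≈ 1#
  inverseˡ x≉0 = proj₁ (proj₂ (invertible _ x≉0))

  inverseʳ : ∀ {x} (x≉0 : ¬ (x ≈ 0#)) → x * inverse x x≉0 ≈ 1#
  inverseʳ x≉0 = proj₂ (proj₂ (invertible _ x≉0))

  cancel : ∀ {x y z} → ¬ (x ≈ 0#) → x * y ≈ x * z → y ≈ z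
  cancel {x} {y} {z} x≉0 eq = begin
    y                         ≈⟨ undo y ⟨
    inverse x x≉0 * (x * y)   ≈⟨ *-congˡ eq ⟩
    inverse x x≉0 * (x * z)   ≈⟨ undo z ⟩
    z                         ∎
    where
    undo : ∀ t → inverse x x≉0 * (x * t) ≈ t
    undo t = trans (sym (*-assoc _ _ _)) (trans (*-congʳ (inverseˡ x≉0)) (*-identityˡ t))

  *-integral : ∀ {x y} → ¬ (x ≈ 0#) → x * y ≈ 0# → y ≈ 0#
  *-integral x≉0 eq = cancel x≉0 (trans eq (sym (zeroʳ _)))

  *-nonzero : ∀ {x y} → ¬ (x ≈ 0#) → ¬ (y ≈ 0#) → ¬ (x * y ≈ 0#)
  *-nonzero x≉0 y≉0 eq = y≉0 (*-integral x≉0 eq)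

  ^-nonzero : ∀ {x} n → ¬ (x ≈ 0#) → ¬ (x ^ n ≈ 0#)
  ^-nonzero zero    x≉0 eq = 0≉1 (sym eq)
  ^-nonzero (suc n) x≉0    = *-nonzero x≉0 (^-nonzero n x≉0)

  -- Any commutative monoid is allowed because the same reindexing is used additively for the
  -- characteristic and multiplicatively for `^-size`.
  module Total {a b} (M : CommutativeMonoid a b) where

    private module M = CommutativeMonoid M
    open Algebra.Properties.CommutativeMonoid.Sum M

    total : (Carrier → M.Carrier) → M.Carrier
    total f = sum (λ i → f (element i))

    total-cong : ∀ {f g} → (∀ x → f x M.≈ g x) → total f M.≈ total g
    total-cong eq = sum-cong-≋ λ i → eq (element i)

    total-∙ : ∀ f g → total (λ x → f x M.∙ g x) M.≈ total f M.∙ total g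
    total-∙ f g = ∑-distrib-+ (f ∘ element) (g ∘ element)

    total-reindex : ∀ f → (∀ {x y} → x ≈ y → f x M.≈ f y) →
                    (g h : Carrier → Carrier) →
                    (∀ {x y} → x ≈ y → g x ≈ g y) → (∀ {x y} → x ≈ y → h x ≈ h y) →
                    (∀ x → g (h x) ≈ x) → (∀ x → h (g x) ≈ x) →
                    total f M.≈ total (f ∘ g)
    total-reindex f f-cong g h g-cong h-cong gh hg =
      M.trans (sum-permute (f ∘ element) (permutation (conj g) (conj h) (conj-inverse g-cong gh) (conj-inverse h-cong hg)))
              (sum-cong-≋ λ i → f-cong (element-index (g (element i))))
      where
      conj : (Carrier → Carrier) → Fin size → Fin size
      conj k i = index (k (element i))

      conj-inverse : ∀ {k l} → (∀ {x y} → x ≈ y → k x ≈ k y) → (∀ x → k (l x) ≈ x) →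
                     ∀ i → conj k (conj l i) ≡ i
      conj-inverse k-cong kl i =
        ≡.trans (index-cong (trans (k-cong (element-index _)) (kl _))) (index-element i)

    total-support : ∀ f x → (∀ {x y} → x ≈ y → f x M.≈ f y) →
                    (∀ y → ¬ (y ≈ x) → f y M.≈ M.ε) → total f M.≈ f x
    total-support f x f-cong vanish = M.trans
      (support (f ∘ element) (index x) λ j j≢i →
        vanish (element j) λ eq → j≢i (≡.trans (≡.sym (index-element j)) (index-cong eq)))
      (f-cong (element-index x))
      where
      support : ∀ {n} (t : Fin n → M.Carrier) i → (∀ j → ¬ (j ≡ i) → t j M.≈ M.ε) → sum t M.≈ t i
      support {suc n} t i vanish = M.trans (sum-remove {i = i} t)
        (M.trans (M.∙-congˡ (M.trans (sum-cong-≋ λ j → vanish _ (Fin.punchInᵢ≢i i j)) (sum-replicate-zero n)))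
                 (M.identityʳ (t i)))

  open Algebra.Properties.Semiring.Mult semiring using () renaming (_×_ to infixr 8 _⊠_)

  -- Translation by 1 permutes the field, so Σ x = Σ (x + 1).
  size-annihilates : size ⊠ 1# ≈ 0#
  size-annihilates = +-cancelˡ (total id) _ _ (begin
    total id + size ⊠ 1#         ≈⟨ +-congˡ (sum-replicate size) ⟨
    total id + total (λ _ → 1#)  ≈⟨ total-∙ id (λ _ → 1#) ⟨
    total (_+ 1#)                ≈⟨ total-reindex id id (_+ 1#) (_- 1#) +-congʳ +-congʳ
                                      (λ x → cancelled x (- 1#) 1# (-‿inverseˡ 1#))
                                      (λ x → cancelled x 1# (- 1#) (-‿inverseʳ 1#)) ⟨
    total id                     ≈⟨ +-identityʳ _ ⟨
    total id + 0#                ∎)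
    where
    open Total +-commutativeMonoid
    open Algebra.Properties.CommutativeMonoid.Sum +-commutativeMonoid using (sum-replicate)
    cancelled : ∀ x y z → y + z ≈ 0# → x + y + z ≈ x
    cancelled x y z eq = trans (+-assoc x y z) (trans (+-congˡ eq) (+-identityʳ x))

  -- Multiplication by x permutes the nonzero elements, so it does not change their product.
  ^-size : ∀ x → ¬ (x ≈ 0#) → x ^ size ≈ x
  ^-size x x≉0 = begin
    x ^ size                               ≈⟨ sum-replicate size ⟨
    total (λ _ → x)                        ≈⟨ total-cong split ⟨
    total (λ y → onUnits y * atZero y)     ≈⟨ total-∙ onUnits atZero ⟩
    total onUnits * total atZero           ≈⟨ *-cong onUnits≈1 atZero≈x ⟩
    1# * x                                 ≈⟨ *-identityˡ x ⟩
    x                                      ∎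
    where
    open Total *-commutativeMonoid
    open Algebra.Properties.CommutativeMonoid.Sum *-commutativeMonoid using (sum; sum-replicate)

    -- The fold also visits 0. There `unit` puts the neutral 1, and `atZero` holds the one factor x
    -- that belongs to this index, so the result is x to the power `size` equal to x rather than the
    -- power `size - 1` equal to 1.
    onUnits atZero unit : Carrier → Carrier
    onUnits y with y ≟ 0#
    ... | yes _ = 1#
    ... | no  _ = x
    atZero y with y ≟ 0#
    ... | yes _ = x
    ... | no  _ = 1#
    unit y with y ≟ 0#
    ... | yes _ = 1#
    ... | no  _ = y

    split : ∀ y → onUnits y * atZero y ≈ x
    split y with y ≟ 0#
    ... | yes _ = *-identityˡ x
    ... | no  _ = *-identityʳ x

    atZero-cong : ∀ {y z} → y ≈ z → atZero y ≈ atZero z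
    atZero-cong {y} {z} eq with y ≟ 0# | z ≟ 0#
    ... | yes _ | yes _ = refl
    ... | no  _ | no  _ = refl
    ... | yes p | no  q = contradiction (trans (sym eq) p) q
    ... | no  p | yes q = contradiction (trans eq q) p

    unit-cong : ∀ {y z} → y ≈ z → unit y ≈ unit z
    unit-cong {y} {z} eq with y ≟ 0# | z ≟ 0#
    ... | yes _ | yes _ = refl
    ... | no  _ | no  _ = eq
    ... | yes p | no  q = contradiction (trans (sym eq) p) q
    ... | no  p | yes q = contradiction (trans eq q) p

    unit-scale : ∀ y → unit (x * y) ≈ onUnits y * unit y
    unit-scale y with x * y ≟ 0# | y ≟ 0#
    ... | yes _ | yes _ = sym (*-identityˡ 1#)
    ... | no  _ | no  _ = refl
    ... | yes p | no  q = contradiction p (*-nonzero x≉0 q)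
    ... | no  p | yes q = contradiction (trans (*-congˡ q) (zeroʳ x)) p

    unit-nonzero : ∀ y → ¬ (unit y ≈ 0#)
    unit-nonzero y with y ≟ 0#
    ... | yes _ = λ eq → 0≉1 (sym eq)
    ... | no  p = p

    product-nonzero : ∀ {n} (t : Fin n → Carrier) → (∀ i → ¬ (t i ≈ 0#)) → ¬ (sum t ≈ 0#)
    product-nonzero {zero}  t nz eq = 0≉1 (sym eq)
    product-nonzero {suc n} t nz    = *-nonzero (nz zero) (product-nonzero (t ∘ suc) (nz ∘ suc))

    x⁻¹ : Carrier
    x⁻¹ = inverse x x≉0

    onUnits≈1 : total onUnits ≈ 1#
    onUnits≈1 = cancel (product-nonzero (unit ∘ element) (unit-nonzero ∘ element)) (begin
      total unit * total onUnits          ≈⟨ *-comm _ _ ⟩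
      total onUnits * total unit          ≈⟨ total-∙ onUnits unit ⟨
      total (λ y → onUnits y * unit y)    ≈⟨ total-cong unit-scale ⟨
      total (λ y → unit (x * y))          ≈⟨ total-reindex unit unit-cong (x *_) (x⁻¹ *_) *-congˡ *-congˡ
                                               (λ y → scaled y (inverseʳ x≉0)) (λ y → scaled y (inverseˡ x≉0)) ⟨
      total unit                          ≈⟨ *-identityʳ _ ⟨
      total unit * 1#                     ∎)
      where
      scaled : ∀ {u v} y → u * v ≈ 1# → u * (v * y) ≈ y
      scaled y eq = trans (sym (*-assoc _ _ y)) (trans (*-congʳ eq) (*-identityˡ y))

    atZero≈x : total atZero ≈ x
    atZero≈x = trans (total-support atZero 0# atZero-cong vanish) value
      where
      value : atZero 0# ≈ x
      value with 0# ≟ 0#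
      ... | yes _ = refl
      ... | no  p = contradiction refl p
      vanish : ∀ y → ¬ (y ≈ 0#) → atZero y ≈ 1#
      vanish y p with y ≟ 0#
      ... | yes q = contradiction q p
      ... | no  _ = refl

-- Characteristic two and ring identities modulo 2.

open +-*-Solver using ()
  renaming (solve to ℕ-solve; con to ℕcon; _:=_ to infix 4 _ℕ:=_; _:+_ to infixl 8 _ℕ:+_; _:*_ to infixl 9 _ℕ:*_)

module BinaryFieldProperties {κ ℓ : Level} {m : ℕ} (𝕄 : FiniteField κ ℓ (2 ℕ.^ m)) where

  open FiniteField 𝕄 hiding (zero)
  open FiniteFieldProperties 𝕄 public
  open Algebra.Properties.Semiring.Exp semiring
  open Algebra.Properties.CommutativeSemiring.Exp commutativeSemiring using (^-distrib-*)
  open Algebra.Properties.Semiring.Mult semiring using (×1-homo-*) renaming (_×_ to infixr 8 _⊠_)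
  open Algebra.Properties.Ring ring using (-0#≈0#; +-inverseˡ-unique)
  open import Relation.Binary.Reasoning.Setoid setoid

  -- `size-annihilates` says that the m-th power of 1 + 1 vanishes, and a field has no nonzero
  -- nilpotents.
  1+1≈0 : 1# + 1# ≈ 0#
  1+1≈0 with 1# + 1# ≟ 0#
  ... | yes eq = eq
  ... | no neq = contradiction size-annihilates (2^n⊠1≉0 m)
    where
    2^n⊠1≉0 : ∀ n → ¬ ((2 ℕ.^ n) ⊠ 1# ≈ 0#)
    2^n⊠1≉0 zero    eq = 0≉1 (sym (trans (sym (+-identityʳ 1#)) eq))
    2^n⊠1≉0 (suc n) eq = *-nonzero
      (λ 2≈0 → neq (trans (+-congˡ (sym (+-identityʳ 1#))) 2≈0)) (2^n⊠1≉0 n)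
      (trans (sym (×1-homo-* 2 (2 ℕ.^ n))) eq)

  private
    fromBool : Bool → Carrier
    fromBool false = 0#
    fromBool true  = 1#

    +-homo : ∀ a b → fromBool (a xor b) ≈ fromBool a + fromBool b
    +-homo false b     = sym (+-identityˡ _)
    +-homo true  false = sym (+-identityʳ 1#)
    +-homo true  true  = sym 1+1≈0

    *-homo : ∀ a b → fromBool (a ∧ b) ≈ fromBool a * fromBool b
    *-homo false b = sym (zeroˡ _)
    *-homo true  b = sym (*-identityˡ _)

    -‿homo : ∀ a → fromBool a ≈ - fromBool a
    -‿homo false = sym -0#≈0#
    -‿homo true  = +-inverseˡ-unique 1# 1# 1+1≈0

    fromBool-homomorphism : CommutativeRing.rawRing xor-∧-commutativeRing
                            -Raw-AlmostCommutative⟶ fromCommutativeRing commutativeRing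
    fromBool-homomorphism = record
      { ⟦_⟧    = fromBool
      ; +-homo = +-homo
      ; *-homo = *-homo
      ; -‿homo = -‿homo
      ; 0-homo = refl
      ; 1-homo = refl
      }

    coefficient≟ : ∀ a b → Maybe (fromBool a ≈ fromBool b)
    coefficient≟ false false = just refl
    coefficient≟ true  true  = just refl
    coefficient≟ _     _     = nothing

  -- Coefficients in Bool let the ring solver use 1 + 1 = 0.
  module Solver = Algebra.Solver.Ring
    (CommutativeRing.rawRing xor-∧-commutativeRing)
    (fromCommutativeRing commutativeRing)
    fromBool-homomorphism
    coefficient≟

  open Solver using (solve; con; _:=_; _:+_; _:*_)

  x+y≈0⇒x≈y : ∀ {x y} → x + y ≈ 0# → x ≈ y
  x+y≈0⇒x≈y {x} {y} eq = begin
    x             ≈⟨ solve 2 (λ x y → x := (x :+ y) :+ y) refl x y ⟩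
    (x + y) + y   ≈⟨ +-congʳ eq ⟩
    0# + y        ≈⟨ +-identityˡ y ⟩
    y             ∎

  x≈y⇒x+y≈0 : ∀ {x y} → x ≈ y → x + y ≈ 0#
  x≈y⇒x+y≈0 {x} {y} eq = trans (+-congʳ eq) (solve 1 (λ y → y :+ y := con false) refl y)

  x²+x≈0⇒x≈0⊎x≈1 : ∀ {x} → x * x + x ≈ 0# → x ≈ 0# ⊎ x ≈ 1#
  x²+x≈0⇒x≈0⊎x≈1 {x} eq with x ≟ 0#
  ... | yes x≈0 = inj₁ x≈0
  ... | no  x≉0 = inj₂ (x+y≈0⇒x≈y (*-integral x≉0
    (trans (solve 1 (λ x → x :* (x :+ con true) := x :* x :+ x) refl x) eq)))

  -- Polynomials and the number of their roots.

  -- Coefficients are listed from the constant term upwards. The leading 1 is left implicit, so the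
  -- length of the vector is the degree and no polynomial is zero.
  monic : ∀ {n} → Vec Carrier n → Carrier → Carrier
  monic []      x = 1#
  monic (c ∷ p) x = c + x * monic p x

  -- The quotient of monic p x - monic p a by x - a.
  quotient : ∀ {n} → Carrier → Vec Carrier (suc n) → Vec Carrier n
  quotient a (c ∷ [])        = []
  quotient a (c ∷ p@(_ ∷ _)) = monic p a ∷ quotient a p

  quotient-correct : ∀ {n} a (p : Vec Carrier (suc n)) x →
                     monic p x + monic p a ≈ (x + a) * monic (quotient a p) x
  quotient-correct a (c ∷ []) x =
    solve 3 (λ a c x → (c :+ x :* con true) :+ (c :+ a :* con true) := (x :+ a) :* con true) refl a c x
  quotient-correct a (c ∷ p@(_ ∷ _)) x = begin
    (c + x * P x) + (c + a * P a)       ≈⟨ solve 5 (λ a c x Px Pa →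
                                             (c :+ x :* Px) :+ (c :+ a :* Pa) := (x :+ a) :* Pa :+ x :* (Px :+ Pa))
                                             refl a c x (P x) (P a) ⟩
    (x + a) * P a + x * (P x + P a)     ≈⟨ +-congˡ (*-congˡ (quotient-correct a p x)) ⟩
    (x + a) * P a + x * ((x + a) * Q)   ≈⟨ solve 4 (λ a x Pa Q → (x :+ a) :* Pa :+ x :* ((x :+ a) :* Q)
                                             := (x :+ a) :* (Pa :+ x :* Q)) refl a x (P a) Q ⟩
    (x + a) * (P a + x * Q)             ∎
    where
    P = monic p
    Q = monic (quotient a p) x

  -- Dividing by X - a for the first root a keeps all the others as roots, because their differences
  -- from a are nonzero and cancel.
  root-bound : ∀ {n} (p : Vec Carrier n) (root : Fin (suc n) → Carrier) →
               (∀ {i j} → root i ≈ root j → i ≡ j) → ¬ (∀ i → monic p (root i) ≈ 0#)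
  root-bound {zero}  []  root root-injective vanish = 0≉1 (sym (vanish zero))
  root-bound {suc n} p root root-injective vanish =
    root-bound (quotient a p) (root ∘ suc) (Fin.suc-injective ∘ root-injective) λ i →
      *-integral
        (λ eq → Fin.0≢1+n (≡.sym (root-injective (x+y≈0⇒x≈y eq))))
        (trans (sym (quotient-correct a p (root (suc i)))) (trans (+-cong (vanish (suc i)) (vanish zero)) (+-identityʳ 0#)))
    where
    a = root zero

  -- Otherwise X^e + X, monic of degree e, would vanish on the whole field; `e<size` supplies just
  -- the e + 1 distinct elements that `root-bound` forbids.
  power-moves : ∀ e → 1 ℕ.< e → e ℕ.< 2 ℕ.^ m → ∃ λ μ → ¬ (μ ^ e ≈ μ)
  power-moves (suc (suc e)) (s≤s (s≤s z≤n)) e<size with fixed-or-moved (_^ (2 ℕ.+ e)) (^-congˡ (2 ℕ.+ e))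
  ... | inj₂ moved = moved
  ... | inj₁ fixed = contradiction vanish
    (root-bound (0# ∷ 1# ∷ replicate e 0#) (λ i → element (inject≤ i e<size))
                (λ eq → Fin.inject≤-injective e<size e<size _ _ (element-injective eq)))
    where
    monic-0 : ∀ n x → monic (replicate n 0#) x ≈ x ^ n
    monic-0 zero    x = refl
    monic-0 (suc n) x = trans (+-identityˡ _) (*-congˡ (monic-0 n x))
    monic-X^e+X : ∀ x → monic (0# ∷ 1# ∷ replicate e 0#) x ≈ x ^ (2 ℕ.+ e) + x
    monic-X^e+X x = trans (+-congˡ (*-congˡ (+-congˡ (*-congˡ (monic-0 e x)))))
      (solve 2 (λ x y → con false :+ x :* (con true :+ x :* y) := x :* (x :* y) :+ x) refl x (x ^ e))
    vanish : ∀ i → monic (0# ∷ 1# ∷ replicate e 0#) (element (inject≤ i e<size)) ≈ 0#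
    vanish i = trans (monic-X^e+X _) (x≈y⇒x+y≈0 (fixed _))

  -- Powers of the Frobenius automorphism.

  frob : ℕ → Carrier → Carrier
  frob n x = x ^ (2 ℕ.^ n)

  frob-cong : ∀ n {x y} → x ≈ y → frob n x ≈ frob n y
  frob-cong n = ^-congˡ (2 ℕ.^ n)

  frob-compose : ∀ j k x → frob (j ℕ.+ k) x ≈ frob k (frob j x)
  frob-compose j k x = begin
    x ^ (2 ℕ.^ (j ℕ.+ k))         ≡⟨ ≡.cong (x ^_) (ℕ.^-distribˡ-+-* 2 j k) ⟩
    x ^ (2 ℕ.^ j ℕ.* 2 ℕ.^ k)     ≈⟨ ^-assocʳ x (2 ℕ.^ j) (2 ℕ.^ k) ⟨
    (x ^ (2 ℕ.^ j)) ^ (2 ℕ.^ k)   ∎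

  frob-comm : ∀ j k x → frob j (frob k x) ≈ frob k (frob j x)
  frob-comm j k x = begin
    frob j (frob k x)   ≈⟨ frob-compose k j x ⟨
    frob (k ℕ.+ j) x    ≡⟨ ≡.cong (λ n → frob n x) (ℕ.+-comm k j) ⟩
    frob (j ℕ.+ k) x    ≈⟨ frob-compose j k x ⟩
    frob k (frob j x)   ∎

  frob-1 : ∀ x → frob 1 x ≈ x * x
  frob-1 x = *-congˡ (*-identityʳ x)

  frob-suc : ∀ n x → frob (suc n) x ≈ frob n (x * x)
  frob-suc n x = trans (frob-compose 1 n x) (frob-cong n (frob-1 x))

  frob-* : ∀ n x y → frob n (x * y) ≈ frob n x * frob n y
  frob-* n x y = ^-distrib-* x y (2 ℕ.^ n)

  frob-+ : ∀ n x y → frob n (x + y) ≈ frob n x + frob n y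
  frob-+ zero    x y = trans (*-identityʳ _) (sym (+-cong (*-identityʳ x) (*-identityʳ y)))
  frob-+ (suc n) x y = begin
    frob (suc n) (x + y)              ≈⟨ frob-suc n (x + y) ⟩
    frob n ((x + y) * (x + y))        ≈⟨ frob-cong n (solve 2 (λ x y →
                                           (x :+ y) :* (x :+ y) := x :* x :+ y :* y) refl x y) ⟩
    frob n (x * x + y * y)            ≈⟨ frob-+ n (x * x) (y * y) ⟩
    frob n (x * x) + frob n (y * y)   ≈⟨ +-cong (frob-suc n x) (frob-suc n y) ⟨
    frob (suc n) x + frob (suc n) y   ∎

  frob-0# : ∀ n → frob n 0# ≈ 0#
  frob-0# n = begin
    frob n 0#               ≈⟨ frob-cong n (+-identityʳ 0#) ⟨
    frob n (0# + 0#)        ≈⟨ frob-+ n 0# 0# ⟩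
    frob n 0# + frob n 0#   ≈⟨ x≈y⇒x+y≈0 refl ⟩
    0#                      ∎

  frob-1# : ∀ n → frob n 1# ≈ 1#
  frob-1# zero    = *-identityʳ 1#
  frob-1# (suc n) = trans (frob-suc n 1#) (trans (frob-cong n (*-identityʳ 1#)) (frob-1# n))

  frob-zero : ∀ n {x} → frob n x ≈ 0# → x ≈ 0#
  frob-zero n {x} eq with x ≟ 0#
  ... | yes x≈0 = x≈0
  ... | no  x≉0 = contradiction eq (^-nonzero (2 ℕ.^ n) x≉0)

  frob-m : ∀ x → frob m x ≈ x
  frob-m x with x ≟ 0#
  ... | yes x≈0 = trans (frob-cong m x≈0) (trans (frob-0# m) (sym x≈0))
  ... | no  x≉0 = ^-size x x≉0

  frob-multiple : ∀ n k {x} → frob k x ≈ x → frob (n ℕ.* k) x ≈ x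
  frob-multiple zero    k {x} eq = *-identityʳ x
  frob-multiple (suc n) k {x} eq = begin
    frob (k ℕ.+ n ℕ.* k) x     ≈⟨ frob-compose k (n ℕ.* k) x ⟩
    frob (n ℕ.* k) (frob k x)  ≈⟨ frob-cong (n ℕ.* k) eq ⟩
    frob (n ℕ.* k) x           ≈⟨ frob-multiple n k eq ⟩
    x                          ∎

  frob-modulo : ∀ r n k {x} → frob k x ≈ x → frob (r ℕ.+ n ℕ.* k) x ≈ frob r x
  frob-modulo r n k {x} eq = begin
    frob (r ℕ.+ n ℕ.* k) x     ≈⟨ frob-compose r (n ℕ.* k) x ⟩
    frob (n ℕ.* k) (frob r x)  ≈⟨ frob-comm (n ℕ.* k) r x ⟩
    frob r (frob (n ℕ.* k) x)  ≈⟨ frob-cong r (frob-multiple n k eq) ⟩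
    frob r x                   ∎

  -- Besides k, the exponent m also fixes x, by `frob-m`. Bézout in the subtraction-free form 1 + j
  -- b = i a then shows that squaring fixes x, without inverting the Frobenius.
  frob-fixed : ∀ k → gcd k m ≡ 1 → ∀ {x} → frob k x ≈ x → x ≈ 0# ⊎ x ≈ 1#
  frob-fixed k coprime {x} fixed = x²+x≈0⇒x≈0⊎x≈1 (x≈y⇒x+y≈0 (trans (sym (frob-1 x)) idempotent))
    where
    combine : ∀ {a b} → frob a x ≈ x → frob b x ≈ x → ∀ i j → 1 ℕ.+ j ℕ.* b ≡ i ℕ.* a → frob 1 x ≈ x
    combine {a} {b} fa fb i j eq = begin
      frob 1 x               ≈⟨ frob-modulo 1 j b fb ⟨
      frob (1 ℕ.+ j ℕ.* b) x ≡⟨ ≡.cong (λ n → frob n x) eq ⟩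
      frob (i ℕ.* a) x       ≈⟨ frob-multiple i a fa ⟩
      x                      ∎
    idempotent : frob 1 x ≈ x
    idempotent with Bézout.identity (≡.subst (GCD k m) coprime (gcd-GCD k m))
    ... | Bézout.+- i j eq = combine fixed (frob-m x) i j eq
    ... | Bézout.-+ i j eq = combine (frob-m x) fixed j i eq

  -- Coprimality keeps m from dividing n k. Reduced modulo m, the automorphism is therefore a power
  -- map of exponent 2^r with 0 < r < m, to which `power-moves` applies.
  frob-moves : .{{_ : ℕ.NonZero m}} → ∀ k → gcd k m ≡ 1 → ∀ n .{{_ : ℕ.NonZero n}} → n ℕ.< m →
               ∃ λ μ → ¬ (frob (n ℕ.* k) μ ≈ μ)
  frob-moves k coprime n n<m with (n ℕ.* k) % m in eq
  ... | zero  = contradiction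
    (∣⇒≤ (coprime-divisor (Coprime.sym (gcd≡1⇒coprime {k} coprime)) (≡.subst (m ∣_) (ℕ.*-comm n k) (m%n≡0⇒n∣m (n ℕ.* k) m eq))))
    (ℕ.<⇒≱ n<m)
  ... | suc r = μ , λ fixed → moved (trans (sym reduced) fixed)
    where
    1+r<m : suc r ℕ.< m
    1+r<m = ≡.subst (ℕ._< m) eq (m%n<n (n ℕ.* k) m)
    mover = power-moves (2 ℕ.^ suc r)
      (ℕ.^-monoʳ-< 2 (s≤s (s≤s z≤n)) {0} {suc r} (s≤s z≤n)) (ℕ.^-monoʳ-< 2 (s≤s (s≤s z≤n)) 1+r<m)
    μ = proj₁ mover
    moved = proj₂ mover
    reduced : frob (n ℕ.* k) μ ≈ frob (suc r) μ
    reduced = begin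
      frob (n ℕ.* k) μ                                            ≡⟨ ≡.cong (λ l → frob l μ) (m≡m%n+[m/n]*n (n ℕ.* k) m) ⟩
      frob ((n ℕ.* k) % m ℕ.+ (n ℕ.* k) / m ℕ.* m) μ             ≡⟨ ≡.cong (λ r → frob (r ℕ.+ (n ℕ.* k) / m ℕ.* m) μ) eq ⟩
      frob (suc r ℕ.+ (n ℕ.* k) / m ℕ.* m) μ                     ≈⟨ frob-modulo (suc r) ((n ℕ.* k) / m) m (frob-m μ) ⟩
      frob (suc r) μ                                              ∎

  -- Since m is even, 2^m = 1 + 3 e. Some μ is moved by the power e + 1, so y = μ^e is not 1, while
  -- its cube is 1; cancelling y + 1 from y³ + 1 leaves the quadratic.
  cube-root-of-unity : .{{_ : ℕ.NonZero m}} → 2 ∣ m → ∃ λ ω → ω * ω + ω + 1# ≈ 0#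
  cube-root-of-unity (divides (suc h) m≡) = y , *-integral (y≉1 ∘ x+y≈0⇒x≈y) (begin
      (y + 1#) * (y * y + y + 1#)   ≈⟨ solve 1 (λ y → (y :+ con true) :* (y :* y :+ y :+ con true)
                                         := y :* (y :* (y :* con true)) :+ con true) refl y ⟩
      y ^ 3 + 1#                    ≈⟨ x≈y⇒x+y≈0 y³≈1 ⟩
      0#                            ∎)
    where
    -- The recursion is 4 (1 + 3 (e + 1)) = 1 + 3 (4 e + 5). Storing the predecessor makes the
    -- quotient visibly positive, as `power-moves` requires an exponent above 1.
    quarter : ∀ h → ∃ λ e → 2 ℕ.^ (suc h ℕ.* 2) ≡ suc (suc e ℕ.* 3)
    quarter zero = 0 , ≡.refl
    quarter (suc h) with e , eq ← quarter h = 4 ℕ.+ 4 ℕ.* e ,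
      ≡.trans (≡.cong (λ n → 2 ℕ.* (2 ℕ.* n)) eq)
        (ℕ-solve 1 (λ e → ℕcon 2 ℕ:* (ℕcon 2 ℕ:* (ℕcon 1 ℕ:+ (ℕcon 1 ℕ:+ e) ℕ:* ℕcon 3))
                     ℕ:= ℕcon 1 ℕ:+ (ℕcon 1 ℕ:+ (ℕcon 4 ℕ:+ ℕcon 4 ℕ:* e)) ℕ:* ℕcon 3) ≡.refl e)
    e = suc (proj₁ (quarter h))
    size≡ : 2 ℕ.^ m ≡ suc (e ℕ.* 3)
    size≡ = ≡.trans (≡.cong (2 ℕ.^_) m≡) (proj₂ (quarter h))
    mover = power-moves (suc e) (s≤s (s≤s z≤n))
      (≡.subst (suc e ℕ.<_) (≡.sym size≡) (s≤s (ℕ.m<m*n e 3 (s≤s (s≤s z≤n)))))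
    μ = proj₁ mover
    y = μ ^ e
    μ≉0 : ¬ (μ ≈ 0#)
    μ≉0 eq = proj₂ mover (trans (*-congʳ eq) (trans (zeroˡ y) (sym eq)))
    y≉1 : ¬ (y ≈ 1#)
    y≉1 eq = proj₂ mover (trans (*-congˡ eq) (*-identityʳ μ))
    y³≈1 : y ^ 3 ≈ 1#
    y³≈1 = cancel μ≉0 (begin
      μ * (μ ^ e) ^ 3       ≈⟨ *-congˡ (^-assocʳ μ e 3) ⟩
      μ ^ suc (e ℕ.* 3)     ≡⟨ ≡.cong (μ ^_) size≡ ⟨
      μ ^ (2 ℕ.^ m)         ≈⟨ ^-size μ μ≉0 ⟩
      μ                     ≈⟨ *-identityʳ μ ⟨
      μ * 1#                ∎)
  cube-root-of-unity (divides zero m≡) = contradiction m≡ (ℕ.≢-nonZero⁻¹ m)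

-- Linear algebra of the plane in characteristic two.

module Plane {κ ℓ : Level} {m : ℕ} (𝕄 : FiniteField κ ℓ (2 ℕ.^ m)) where

  open FiniteField 𝕄 hiding (zero)
  open BinaryFieldProperties {m = m} 𝕄
  open Functions {m = m} 𝕄 using (V; _≈ⱽ_; _+ⱽ_)
  open Solver using (solve; con; _:=_; _:+_; _:*_)
  open Algebra.Properties.Ring ring using (+-cancelˡ; +-cancelʳ)

  open Setoid (×-setoid setoid setoid) public using ()
    renaming (refl to reflⱽ; sym to symⱽ; trans to transⱽ)
  module ≈-Reasoning = SetoidReasoning setoid
  module ⱽ-Reasoning = SetoidReasoning (×-setoid setoid setoid)

  0ⱽ e₁ e₂ : V
  0ⱽ = 0# , 0#
  e₁ = 1# , 0#
  e₂ = 0# , 1#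

  infixr 8 _·_
  _·_ : Carrier → V → V
  l · (x , y) = l * x , l * y

  det : V → V → Carrier
  det (x , y) (x′ , y′) = x * y′ + y * x′

  +ⱽ-cong : ∀ {v v′ w w′} → v ≈ⱽ v′ → w ≈ⱽ w′ → v +ⱽ w ≈ⱽ v′ +ⱽ w′
  +ⱽ-cong (p , q) (p′ , q′) = +-cong p p′ , +-cong q q′

  +ⱽ-identityʳ : ∀ v → v +ⱽ 0ⱽ ≈ⱽ v
  +ⱽ-identityʳ (x , y) = +-identityʳ x , +-identityʳ y

  +ⱽ-cancelˡ : ∀ u {v w} → u +ⱽ v ≈ⱽ u +ⱽ w → v ≈ⱽ w
  +ⱽ-cancelˡ u (p , q) = +-cancelˡ _ _ _ p , +-cancelˡ _ _ _ q

  +ⱽ-cancelʳ : ∀ u {v w} → v +ⱽ u ≈ⱽ w +ⱽ u → v ≈ⱽ w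
  +ⱽ-cancelʳ u (p , q) = +-cancelʳ _ _ _ p , +-cancelʳ _ _ _ q

  ·-cong : ∀ {l l′ v v′} → l ≈ l′ → v ≈ⱽ v′ → l · v ≈ⱽ l′ · v′
  ·-cong eq (p , q) = *-cong eq p , *-cong eq q

  ·-integral : ∀ {l v} → ¬ (l ≈ 0#) → l · v ≈ⱽ 0ⱽ → v ≈ⱽ 0ⱽ
  ·-integral l≉0 (p , q) = *-integral l≉0 p , *-integral l≉0 q

  det-cong : ∀ {v v′ w w′} → v ≈ⱽ v′ → w ≈ⱽ w′ → det v w ≈ det v′ w′
  det-cong (p , q) (p′ , q′) = +-cong (*-cong p q′) (*-cong q p′)

  det-self : ∀ v → det v v ≈ 0#
  det-self (x , y) = solve 2 (λ x y → x :* y :+ y :* x := con false) refl x y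

  det-mul : ∀ a b c d p r s u →
            det (a * p + b * s , c * p + d * s) (a * r + b * u , c * r + d * u) ≈ (a * d + b * c) * (p * u + s * r)
  det-mul = solve 8 (λ a b c d p r s u →
    (a :* p :+ b :* s) :* (c :* r :+ d :* u) :+ (c :* p :+ d :* s) :* (a :* r :+ b :* u)
    := (a :* d :+ b :* c) :* (p :* u :+ s :* r)) refl

  -- With A = (a b; c d) and P = (p r; s u), this is det (P A) by columns, where `det-mul` is det (A
  -- P). Both occur because `T` commutes with `φ`.
  det-mulᵗ : ∀ a b c d p r s u →
             det (a * p + c * r , a * s + c * u) (b * p + d * r , b * s + d * u) ≈ (a * d + b * c) * (p * u + s * r)
  det-mulᵗ = solve 8 (λ a b c d p r s u →
    (a :* p :+ c :* r) :* (b :* s :+ d :* u) :+ (a :* s :+ c :* u) :* (b :* p :+ d :* r)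
    := (a :* d :+ b :* c) :* (p :* u :+ s :* r)) refl

  -- With A = (a b; c d) and P = (p r; s u): tr (adj A · A P) = det A · tr P.
  adjugate-trace : ∀ a b c d p r s u →
    (d * (a * p + b * s) + b * (c * p + d * s)) + (c * (a * r + b * u) + a * (c * r + d * u)) ≈ (a * d + b * c) * (p + u)
  adjugate-trace = solve 8 (λ a b c d p r s u →
    (d :* (a :* p :+ b :* s) :+ b :* (c :* p :+ d :* s)) :+ (c :* (a :* r :+ b :* u) :+ a :* (c :* r :+ d :* u))
    := (a :* d :+ b :* c) :* (p :+ u)) refl

  -- Cyclicity of the trace: tr (adj A · P A) = tr (P · A adj A). The adjugate replaces the inverse
  -- of A, so this stays a polynomial identity.
  adjugate-traceᵗ : ∀ a b c d p r s u →
    (d * (a * p + c * r) + b * (a * s + c * u)) + (c * (b * p + d * r) + a * (b * s + d * u)) ≈ (a * d + b * c) * (p + u)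
  adjugate-traceᵗ = solve 8 (λ a b c d p r s u →
    (d :* (a :* p :+ c :* r) :+ b :* (a :* s :+ c :* u)) :+ (c :* (b :* p :+ d :* r) :+ a :* (b :* s :+ d :* u))
    := (a :* d :+ b :* c) :* (p :+ u)) refl

  -- A singular matrix with rows (p , r) and (s , u) kills (r , p) and (u , s).
  singular⇒kernel : ∀ p r s u → p * u + r * s ≈ 0# →
                    ∃ λ v → ¬ (v ≈ⱽ 0ⱽ) × (proj₁ v * p + proj₂ v * r , proj₁ v * s + proj₂ v * u) ≈ⱽ 0ⱽ
  singular⇒kernel p r s u singular with p ≟ 0# | r ≟ 0# | s ≟ 0# | u ≟ 0#
  ... | no p≉0  | _       | _       | _       = (r , p) , (λ eq → p≉0 (proj₂ eq)) ,
    det-self (r , p) , trans (solve 4 (λ p r s u → r :* s :+ p :* u := p :* u :+ r :* s) refl p r s u) singular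
  ... | _       | no r≉0  | _       | _       = (r , p) , (λ eq → r≉0 (proj₁ eq)) ,
    det-self (r , p) , trans (solve 4 (λ p r s u → r :* s :+ p :* u := p :* u :+ r :* s) refl p r s u) singular
  ... | yes _   | yes _   | no s≉0  | _       = (u , s) , (λ eq → s≉0 (proj₂ eq)) ,
    trans (solve 4 (λ p r s u → u :* p :+ s :* r := p :* u :+ r :* s) refl p r s u) singular , det-self (u , s)
  ... | yes _   | yes _   | _       | no u≉0  = (u , s) , (λ eq → u≉0 (proj₁ eq)) ,
    trans (solve 4 (λ p r s u → u :* p :+ s :* r := p :* u :+ r :* s) refl p r s u) singular , det-self (u , s)
  ... | yes p≈0 | yes r≈0 | yes s≈0 | yes u≈0 = e₁ , (λ eq → 0≉1 (sym (proj₁ eq))) , zeros p≈0 , zeros s≈0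
    where
    zeros : ∀ {x y} → x ≈ 0# → 1# * x + 0# * y ≈ 0#
    zeros {x} {y} eq = trans (solve 2 (λ x y → con true :* x :+ con false :* y := x) refl x y) eq

-- Dedekind independence of the powers of σ.

module Semilinear {κ ℓ : Level} {m : ℕ} .{{_ : ℕ.NonZero m}} (𝕄 : FiniteField κ ℓ (2 ℕ.^ m))
                  (k : ℕ) (coprime : gcd k m ≡ 1) where

  open FiniteField 𝕄 hiding (zero)
  open BinaryFieldProperties {m = m} 𝕄
  open Functions {m = m} 𝕄 using (V; _≈ⱽ_; _+ⱽ_)
  open Plane {m = m} 𝕄
  open Solver using (solve; con; _:=_; _:+_; _:*_)


  σ : Carrier → Carrier
  σ = frob k

  orbitSum : ℕ → (ℕ → Carrier) → Carrier → Carrier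
  orbitSum zero    c l = 0#
  orbitSum (suc n) c l = orbitSum n c l + frob (n ℕ.* k) l * c n

  -- Dedekind: with σⁿ μ ≠ μ, evaluating at μ l and subtracting σⁿ μ times the
  -- value at l removes the last summand and keeps the first one nonzero.
  orbitSum-nonzero : ∀ n c → n ℕ.< m → ¬ (c 0 ≈ 0#) → ∃ λ l → ¬ (orbitSum (suc n) c l ≈ 0#)
  orbitSum-nonzero zero c 0<m c₀≉0 = 1# , λ eq → c₀≉0 (begin
    c 0                         ≈⟨ solve 1 (λ c → c := con false :+ con true :* c) refl (c 0) ⟩
    0# + 1# * c 0               ≈⟨ +-congˡ (*-congʳ (*-identityʳ 1#)) ⟨
    0# + frob 0 1# * c 0        ≈⟨ eq ⟩
    0#                          ∎)
    where open ≈-Reasoning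
  orbitSum-nonzero (suc n) c 1+n<m c₀≉0 with frob-moves k coprime (suc n) 1+n<m
  ... | μ , moved = nonzero
    where
    open ≈-Reasoning
    N = suc n
    ν = frob (N ℕ.* k) μ
    c′ : ℕ → Carrier
    c′ i = (frob (i ℕ.* k) μ + ν) * c i

    c′₀≉0 : ¬ (c′ 0 ≈ 0#)
    c′₀≉0 = *-nonzero (λ eq → moved (trans (sym (x+y≈0⇒x≈y eq)) (*-identityʳ μ))) c₀≉0

    difference : ∀ j l → orbitSum j c′ l ≈ orbitSum j c (μ * l) + ν * orbitSum j c l
    difference zero    l = solve 1 (λ ν → con false := con false :+ ν :* con false) refl ν
    difference (suc j) l = begin
      orbitSum j c′ l + f l * ((f μ + ν) * c j)
        ≈⟨ +-congʳ (difference j l) ⟩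
      (orbitSum j c (μ * l) + ν * orbitSum j c l) + f l * ((f μ + ν) * c j)
        ≈⟨ solve 6 (λ A B ν fl fμ c → (A :+ ν :* B) :+ fl :* ((fμ :+ ν) :* c)
                    := (A :+ (fμ :* fl) :* c) :+ ν :* (B :+ fl :* c))
             refl (orbitSum j c (μ * l)) (orbitSum j c l) ν (f l) (f μ) (c j) ⟩
      (orbitSum j c (μ * l) + (f μ * f l) * c j) + ν * orbitSum (suc j) c l
        ≈⟨ +-congʳ (+-congˡ (*-congʳ (frob-* (j ℕ.* k) μ l))) ⟨
      orbitSum (suc j) c (μ * l) + ν * orbitSum (suc j) c l ∎
      where
      f : Carrier → Carrier
      f = frob (j ℕ.* k)

    eliminated : ∀ l → orbitSum N c′ l ≈ orbitSum (suc N) c (μ * l) + ν * orbitSum (suc N) c l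
    eliminated l = begin
      orbitSum N c′ l
        ≈⟨ solve 4 (λ A f ν c → A := A :+ f :* ((ν :+ ν) :* c)) refl (orbitSum N c′ l) (frob (N ℕ.* k) l) ν (c N) ⟩
      orbitSum (suc N) c′ l
        ≈⟨ difference (suc N) l ⟩
      orbitSum (suc N) c (μ * l) + ν * orbitSum (suc N) c l ∎

    nonzero : ∃ λ l → ¬ (orbitSum (suc N) c l ≈ 0#)
    nonzero with orbitSum-nonzero n c′ (ℕ.<-trans (ℕ.n<1+n n) 1+n<m) c′₀≉0
    ... | l , D≉0 with orbitSum (suc N) c (μ * l) ≟ 0# | orbitSum (suc N) c l ≟ 0#
    ...   | no  p | _     = μ * l , p
    ...   | _     | no  q = l , q
    ...   | yes p | yes q = contradiction
      (trans (eliminated l) (trans (+-cong p (trans (*-congˡ q) (zeroʳ ν))) (+-identityʳ 0#))) D≉0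

  -- Iterates of a semilinear map and the matrix of `T`.

  module _ (a b c d : Carrier) where

    φ : V → V
    φ (x , y) = a * σ x + b * σ y , c * σ x + d * σ y

    φ^ : ℕ → V → V
    φ^ zero    v = v
    φ^ (suc n) v = φ (φ^ n v)

    φ-cong : ∀ {v w} → v ≈ⱽ w → φ v ≈ⱽ φ w
    φ-cong (p , q) = row a b , row c d
      where
      row : ∀ g h → g * σ _ + h * σ _ ≈ g * σ _ + h * σ _
      row g h = +-cong (*-congˡ (frob-cong k p)) (*-congˡ (frob-cong k q))

    φ-+ : ∀ v w → φ (v +ⱽ w) ≈ⱽ φ v +ⱽ φ w
    φ-+ (x , y) (x′ , y′) = row a b , row c d
      where
      row : ∀ g h → g * σ (x + x′) + h * σ (y + y′) ≈ (g * σ x + h * σ y) + (g * σ x′ + h * σ y′)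
      row g h = trans (+-cong (*-congˡ (frob-+ k x x′)) (*-congˡ (frob-+ k y y′)))
        (solve 6 (λ g h x y x′ y′ → g :* (x :+ x′) :+ h :* (y :+ y′) := (g :* x :+ h :* y) :+ (g :* x′ :+ h :* y′))
          refl g h (σ x) (σ y) (σ x′) (σ y′))

    φ-· : ∀ l v → φ (l · v) ≈ⱽ σ l · φ v
    φ-· l (x , y) = row a b , row c d
      where
      row : ∀ g h → g * σ (l * x) + h * σ (l * y) ≈ σ l * (g * σ x + h * σ y)
      row g h = trans (+-cong (*-congˡ (frob-* k l x)) (*-congˡ (frob-* k l y)))
        (solve 5 (λ g h l x y → g :* (l :* x) :+ h :* (l :* y) := l :* (g :* x :+ h :* y))
          refl g h (σ l) (σ x) (σ y))

    φ^-cong : ∀ n {v w} → v ≈ⱽ w → φ^ n v ≈ⱽ φ^ n w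
    φ^-cong zero    eq = eq
    φ^-cong (suc n) eq = φ-cong (φ^-cong n eq)

    φ^-+ : ∀ n v w → φ^ n (v +ⱽ w) ≈ⱽ φ^ n v +ⱽ φ^ n w
    φ^-+ zero    v w = reflⱽ
    φ^-+ (suc n) v w = transⱽ (φ-cong (φ^-+ n v w)) (φ-+ (φ^ n v) (φ^ n w))

    φ^-· : ∀ n l v → φ^ n (l · v) ≈ⱽ frob (n ℕ.* k) l · φ^ n v
    φ^-· zero    l v = ·-cong (sym (*-identityʳ l)) reflⱽ
    φ^-· (suc n) l v = begin
      φ (φ^ n (l · v))                          ≈⟨ φ-cong (φ^-· n l v) ⟩
      φ (frob (n ℕ.* k) l · φ^ n v)             ≈⟨ φ-· (frob (n ℕ.* k) l) (φ^ n v) ⟩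
      frob k (frob (n ℕ.* k) l) · φ^ (suc n) v  ≈⟨ ·-cong (trans (frob-compose k (n ℕ.* k) l) (frob-comm (n ℕ.* k) k l)) reflⱽ ⟨
      frob (suc n ℕ.* k) l · φ^ (suc n) v       ∎
      where open ⱽ-Reasoning

    φ^-comm : ∀ n v → φ^ n (φ v) ≡ φ (φ^ n v)
    φ^-comm zero    v = ≡.refl
    φ^-comm (suc n) v = ≡.cong φ (φ^-comm n v)

    T : V → V
    T = φ^ m

    -- The twist accumulated over m steps is σᵐ, which is also the k-fold iterate of `frob m` and
    -- hence the identity.
    T-· : ∀ l v → T (l · v) ≈ⱽ l · T v
    T-· l v = transⱽ (φ^-· m l v) (·-cong linear reflⱽ)
      where
      linear : frob (m ℕ.* k) l ≈ l
      linear = trans (reflexive (≡.cong (λ n → frob n l) (ℕ.*-comm m k))) (frob-multiple k m (frob-m l))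

    p r s u tr Δ : Carrier
    p  = proj₁ (T e₁)
    r  = proj₁ (T e₂)
    s  = proj₂ (T e₁)
    u  = proj₂ (T e₂)
    tr = p + u
    Δ  = p * u + s * r

    T-matrix : ∀ v → T v ≈ⱽ proj₁ v · T e₁ +ⱽ proj₂ v · T e₂
    T-matrix v@(x , y) = begin
      T v                              ≈⟨ φ^-cong m (left , right) ⟩
      T (x · e₁ +ⱽ y · e₂)             ≈⟨ φ^-+ m (x · e₁) (y · e₂) ⟩
      T (x · e₁) +ⱽ T (y · e₂)         ≈⟨ +ⱽ-cong (T-· x e₁) (T-· y e₂) ⟩
      x · T e₁ +ⱽ y · T e₂             ∎
      where
      open ⱽ-Reasoning
      left : x ≈ x * 1# + y * 0#
      left = solve 2 (λ x y → x := x :* con true :+ y :* con false) refl x y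
      right : y ≈ x * 0# + y * 1#
      right = solve 2 (λ x y → y := x :* con false :+ y :* con true) refl x y

    eigenvector : ∀ l → l * l + l * tr + Δ ≈ 0# → ∃ λ v → ¬ (v ≈ⱽ 0ⱽ) × T v ≈ⱽ l · v
    eigenvector l eq with singular⇒kernel (p + l) r s (u + l) singular
      where
      singular : (p + l) * (u + l) + r * s ≈ 0#
      singular = trans (solve 5 (λ l p r s u → (p :+ l) :* (u :+ l) :+ r :* s
                                 := l :* l :+ l :* (p :+ u) :+ (p :* u :+ s :* r)) refl l p r s u) eq
    ... | v@(x , y) , v≉0 , k₁ , k₂ = v , v≉0 , transⱽ (T-matrix v)
      ( x+y≈0⇒x≈y (trans (solve 5 (λ l x y p r → (x :* p :+ y :* r) :+ l :* x := x :* (p :+ l) :+ y :* r) refl l x y p r) k₁)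
      , x+y≈0⇒x≈y (trans (solve 5 (λ l x y s u → (x :* s :+ y :* u) :+ l :* y := x :* s :+ y :* (u :+ l)) refl l x y s u) k₂))

    -- First column of P A = A σ(P), the matrix form of `T` commuting with `φ`; here σ(P) has σ
    -- applied to every entry of P.
    T-φe₁ : (a * p + c * r , a * s + c * u) ≈ⱽ φ (T e₁)
    T-φe₁ = begin
      a · T e₁ +ⱽ c · T e₂   ≈⟨ T-matrix (a , c) ⟨
      T (a , c)              ≈⟨ φ^-cong m (column a b , column c d) ⟨
      T (φ e₁)               ≡⟨ φ^-comm m e₁ ⟩
      φ (T e₁)               ∎
      where
      open ⱽ-Reasoning
      column : ∀ g h → g * σ 1# + h * σ 0# ≈ g
      column g h = trans (+-cong (*-congˡ (frob-1# k)) (*-congˡ (frob-0# k)))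
        (solve 2 (λ g h → g :* con true :+ h :* con false := g) refl g h)

    T-φe₂ : (b * p + d * r , b * s + d * u) ≈ⱽ φ (T e₂)
    T-φe₂ = begin
      b · T e₁ +ⱽ d · T e₂   ≈⟨ T-matrix (b , d) ⟨
      T (b , d)              ≈⟨ φ^-cong m (column a b , column c d) ⟨
      T (φ e₂)               ≡⟨ φ^-comm m e₂ ⟩
      φ (T e₂)               ∎
      where
      open ⱽ-Reasoning
      column : ∀ g h → g * σ 0# + h * σ 1# ≈ h
      column g h = trans (+-cong (*-congˡ (frob-0# k)) (*-congˡ (frob-1# k)))
        (solve 2 (λ g h → g :* con false :+ h :* con true := h) refl g h)

    -- Sums over an orbit.

    partialSum : ℕ → V → V
    partialSum zero    v = 0ⱽ
    partialSum (suc n) v = partialSum n v +ⱽ φ^ n v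

    -- Both sides are the sum of φⁱ v over 0 ≤ i ≤ n.
    partialSum-telescope : ∀ n v → φ (partialSum n v) +ⱽ v ≈ⱽ partialSum n v +ⱽ φ^ n v
    partialSum-telescope zero v = +ⱽ-cong (row a b , row c d) reflⱽ
      where
      row : ∀ g h → g * σ 0# + h * σ 0# ≈ 0#
      row g h = trans (+-cong (*-congˡ (frob-0# k)) (*-congˡ (frob-0# k)))
        (solve 2 (λ g h → g :* con false :+ h :* con false := con false) refl g h)
    partialSum-telescope (suc n) v = begin
      φ (S +ⱽ φ^ n v) +ⱽ v           ≈⟨ +ⱽ-cong (φ-+ S (φ^ n v)) reflⱽ ⟩
      (φ S +ⱽ φ^ (suc n) v) +ⱽ v     ≈⟨ swapⱽ (φ S) (φ^ (suc n) v) v ⟩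
      (φ S +ⱽ v) +ⱽ φ^ (suc n) v     ≈⟨ +ⱽ-cong (partialSum-telescope n v) reflⱽ ⟩
      (S +ⱽ φ^ n v) +ⱽ φ^ (suc n) v  ∎
      where
      open ⱽ-Reasoning
      S = partialSum n v
      swap : ∀ x y z → (x + y) + z ≈ (x + z) + y
      swap = solve 3 (λ x y z → (x :+ y) :+ z := (x :+ z) :+ y) refl
      swapⱽ : ∀ x y z → (x +ⱽ y) +ⱽ z ≈ⱽ (x +ⱽ z) +ⱽ y
      swapⱽ (x , x′) (y , y′) (z , z′) = swap x y z , swap x′ y′ z′

    -- Semilinearity turns each coordinate, as a function of l, into a combination of the σⁱ, so
    -- that `orbitSum-nonzero` can be applied to it.
    partialSum-· : ∀ n l v → partialSum n (l · v) ≈ⱽ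
                   (orbitSum n (λ i → proj₁ (φ^ i v)) l , orbitSum n (λ i → proj₂ (φ^ i v)) l)
    partialSum-· zero    l v = reflⱽ
    partialSum-· (suc n) l v = +ⱽ-cong (partialSum-· n l v) (φ^-· n l v)

    -- Hilbert 90 and the eigenlines of `T`.

    module _ (φ-regular : ¬ (a * d + b * c ≈ 0#)) (anisotropic : ∀ v → det (φ v) v ≈ 0# → v ≈ⱽ 0ⱽ) where

      φ-kernel : ∀ v → φ v ≈ⱽ 0ⱽ → v ≈ⱽ 0ⱽ
      φ-kernel v φv≈0 = anisotropic v (trans (det-cong φv≈0 (reflⱽ {v}))
        (solve 2 (λ x y → con false :* y :+ con false :* x := con false) refl (proj₁ v) (proj₂ v)))

      φ^-kernel : ∀ n v → φ^ n v ≈ⱽ 0ⱽ → v ≈ⱽ 0ⱽ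
      φ^-kernel zero    v eq = eq
      φ^-kernel (suc n) v eq = φ^-kernel n v (φ-kernel (φ^ n v) eq)

      -- Hilbert 90: from w fixed by T = φᵐ, Σᵢ φⁱ (l w) is fixed by φ, hence zero, for every l.
      T-fixed : ∀ w → T w ≈ⱽ w → w ≈ⱽ 0ⱽ
      T-fixed w fixed =
        coordinate (λ i → proj₁ (φ^ i w)) (λ l → trans (sym (proj₁ (partialSum-· m l w))) (proj₁ (sumZero l))) ,
        coordinate (λ i → proj₂ (φ^ i w)) (λ l → trans (sym (proj₂ (partialSum-· m l w))) (proj₂ (sumZero l)))
        where
        sumFixed : ∀ l → φ (partialSum m (l · w)) ≈ⱽ partialSum m (l · w)
        sumFixed l = +ⱽ-cancelʳ (l · w) (begin
          φ S +ⱽ l · w          ≈⟨ partialSum-telescope m (l · w) ⟩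
          S +ⱽ T (l · w)        ≈⟨ +ⱽ-cong (reflⱽ {S}) (transⱽ (T-· l w) (·-cong refl fixed)) ⟩
          S +ⱽ l · w            ∎)
          where
          open ⱽ-Reasoning
          S = partialSum m (l · w)

        sumZero : ∀ l → partialSum m (l · w) ≈ⱽ 0ⱽ
        sumZero l = anisotropic S (trans (det-cong (sumFixed l) (reflⱽ {S})) (det-self S))
          where S = partialSum m (l · w)

        -- For the two sequences in use, `c 0` is a coordinate of `w` itself, because `φ^ 0` is the
        -- identity.
        coordinate : ∀ c → (∀ l → orbitSum m c l ≈ 0#) → c 0 ≈ 0#
        coordinate c vanish with c 0 ≟ 0#
        ... | yes c₀≈0 = c₀≈0
        ... | no  c₀≉0 with l , nonzero ← orbitSum-nonzero (ℕ.pred m) c (ℕ.≤-reflexive (ℕ.suc-pred m)) c₀≉0 =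
          contradiction (≡.subst (λ n → orbitSum n c l ≈ 0#) (≡.sym (ℕ.suc-pred m)) (vanish l)) nonzero

      -- If 0 were an eigenvalue, some nonzero vector would be killed by a power of the injective
      -- map `φ`.
      Δ≉0 : ¬ (Δ ≈ 0#)
      Δ≉0 Δ≈0 = let v , v≉0 , Tv≈0v = eigenvector 0# root in
        v≉0 (φ^-kernel m v (transⱽ Tv≈0v (zeroˡ _ , zeroˡ _)))
        where
        root : 0# * 0# + 0# * tr + Δ ≈ 0#
        root = trans (solve 2 (λ t D → con false :* con false :+ con false :* t :+ D := D) refl tr Δ) Δ≈0

      -- Take determinants in P A = A σ(P) and cancel det A.
      Δ-fixed : σ Δ ≈ Δ
      Δ-fixed = cancel φ-regular (begin
        (a * d + b * c) * σ Δ                       ≈⟨ *-congˡ (trans (frob-+ k (p * u) (s * r)) (+-cong (frob-* k p u) (frob-* k s r))) ⟩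
        (a * d + b * c) * (σ p * σ u + σ s * σ r)   ≈⟨ det-mul a b c d (σ p) (σ r) (σ s) (σ u) ⟨
        det (φ (T e₁)) (φ (T e₂))                   ≈⟨ det-cong T-φe₁ T-φe₂ ⟨
        det (a * p + c * r , a * s + c * u) (b * p + d * r , b * s + d * u)
                                                    ≈⟨ det-mulᵗ a b c d p r s u ⟩
        (a * d + b * c) * Δ                         ∎)
        where open ≈-Reasoning

      Δ≈1 : Δ ≈ 1#
      Δ≈1 = [ (λ Δ≈0 → contradiction Δ≈0 Δ≉0) , id ]′ (frob-fixed k coprime Δ-fixed)

      -- Multiply P A = A σ(P) on the left by adj A, take traces and cancel det A.
      tr-fixed : σ tr ≈ tr
      tr-fixed = cancel φ-regular (begin
        (a * d + b * c) * σ tr          ≈⟨ *-congˡ (frob-+ k p u) ⟩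
        (a * d + b * c) * (σ p + σ u)   ≈⟨ adjugate-trace a b c d (σ p) (σ r) (σ s) (σ u) ⟨
        (d * proj₁ (φ (T e₁)) + b * proj₂ (φ (T e₁))) + (c * proj₁ (φ (T e₂)) + a * proj₂ (φ (T e₂)))
          ≈⟨ +-cong (+-cong (*-congˡ (proj₁ T-φe₁)) (*-congˡ (proj₂ T-φe₁)))
                    (+-cong (*-congˡ (proj₁ T-φe₂)) (*-congˡ (proj₂ T-φe₂))) ⟨
        (d * (a * p + c * r) + b * (a * s + c * u)) + (c * (b * p + d * r) + a * (b * s + d * u))
                                        ≈⟨ adjugate-traceᵗ a b c d p r s u ⟩
        (a * d + b * c) * tr            ∎)
        where open ≈-Reasoning

      -- With determinant 1 and trace 0 the characteristic polynomial would be (X + 1)², so `T`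
      -- would have a nonzero fixed vector.
      tr≉0 : ¬ (tr ≈ 0#)
      tr≉0 tr≈0 = let v , v≉0 , Tv≈1v = eigenvector 1# root in
        v≉0 (T-fixed v (transⱽ Tv≈1v (*-identityˡ _ , *-identityˡ _)))
        where
        open ≈-Reasoning
        root : 1# * 1# + 1# * tr + Δ ≈ 0#
        root = begin
          1# * 1# + 1# * tr + Δ      ≈⟨ +-cong (+-congˡ (*-congˡ tr≈0)) Δ≈1 ⟩
          1# * 1# + 1# * 0# + 1#     ≈⟨ solve 0 (con true :* con true :+ con true :* con false :+ con true := con false) refl ⟩
          0#                         ∎

      tr≈1 : tr ≈ 1#
      tr≈1 = [ (λ tr≈0 → contradiction tr≈0 tr≉0) , id ]′ (frob-fixed k coprime tr-fixed)

      -- φ interchanges the two eigenlines of T because σ ω = ω + 1.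
      eigenlines-swapped : ∀ {ω v} → ω * ω + ω + 1# ≈ 0# → ¬ (v ≈ⱽ 0ⱽ) → T v ≈ⱽ ω · v → det (φ (φ v)) v ≈ 0#
      eigenlines-swapped {ω} {v} ω²+ω+1≈0 v≉0 Tv≈ωv = proportional
        where
        w z : V
        w = φ v
        z = φ w

        σω≉ω : ¬ (σ ω ≈ ω)
        σω≉ω fixed = 0≉1 (sym (begin
          1#                     ≈⟨ +-identityˡ 1# ⟨
          0# + 1#                ≈⟨ +-congʳ ([ at0 , at1 ]′ (frob-fixed k coprime fixed)) ⟨
          (ω * ω + ω) + 1#       ≈⟨ ω²+ω+1≈0 ⟩
          0#                     ∎))
          where
          open ≈-Reasoning
          at0 : ω ≈ 0# → ω * ω + ω ≈ 0#
          at0 ω≈0 = trans (+-cong (trans (*-congˡ ω≈0) (zeroʳ ω)) ω≈0) (+-identityʳ 0#)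
          at1 : ω ≈ 1# → ω * ω + ω ≈ 0#
          at1 ω≈1 = x≈y⇒x+y≈0 (trans (*-congˡ ω≈1) (*-identityʳ ω))

        -- σ ω is again a root of X² + X + 1, whose roots are ω and ω + 1; the first is excluded.
        σω≈ω+1 : σ ω ≈ ω + 1#
        σω≈ω+1 = x+y≈0⇒x≈y (*-integral (σω≉ω ∘ x+y≈0⇒x≈y) (begin
          (σ ω + ω) * (σ ω + (ω + 1#))                ≈⟨ solve 2 (λ x y → (x :+ y) :* (x :+ (y :+ con true))
                                                           := (x :* x :+ x :+ con true) :+ (y :* y :+ y :+ con true)) refl (σ ω) ω ⟩
          (σ ω * σ ω + σ ω + 1#) + (ω * ω + ω + 1#)   ≈⟨ +-cong σ-root ω²+ω+1≈0 ⟩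
          0# + 0#                                     ≈⟨ +-identityʳ 0# ⟩
          0#                                          ∎))
          where
          open ≈-Reasoning
          σ-root : σ ω * σ ω + σ ω + 1# ≈ 0#
          σ-root = begin
            σ ω * σ ω + σ ω + 1#        ≈⟨ +-cong (+-congʳ (frob-* k ω ω)) (frob-1# k) ⟨
            σ (ω * ω) + σ ω + σ 1#      ≈⟨ +-congʳ (frob-+ k (ω * ω) ω) ⟨
            σ (ω * ω + ω) + σ 1#        ≈⟨ frob-+ k (ω * ω + ω) 1# ⟨
            σ (ω * ω + ω + 1#)          ≈⟨ frob-cong k ω²+ω+1≈0 ⟩
            σ 0#                        ≈⟨ frob-0# k ⟩
            0#                          ∎

        φ-eigen : ∀ {l v} → T v ≈ⱽ l · v → T (φ v) ≈ⱽ σ l · φ v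
        φ-eigen {l} {v} eq = begin
          T (φ v)      ≡⟨ φ^-comm m v ⟩
          φ (T v)      ≈⟨ φ-cong eq ⟩
          φ (l · v)    ≈⟨ φ-· l v ⟩
          σ l · φ v    ∎
          where open ⱽ-Reasoning

        Tw : T w ≈ⱽ (ω + 1#) · w
        Tw = transⱽ (φ-eigen Tv≈ωv) (·-cong σω≈ω+1 reflⱽ)

        Tz : T z ≈ⱽ ω · z
        Tz = transⱽ (φ-eigen Tw) (·-cong (begin
          σ (ω + 1#)    ≈⟨ frob-+ k ω 1# ⟩
          σ ω + σ 1#    ≈⟨ +-cong σω≈ω+1 (frob-1# k) ⟩
          (ω + 1#) + 1# ≈⟨ solve 1 (λ x → (x :+ con true) :+ con true := x) refl ω ⟩
          ω             ∎) reflⱽ)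
          where open ≈-Reasoning

        -- If the ω-eigenvectors z and v were independent, `T` would be multiplication by ω on the
        -- whole plane. The Plücker identity, which is Cramer's rule without division, writes a
        -- multiple of w in terms of them; comparison with the eigenvalue ω + 1 of w then forces w =
        -- 0.
        proportional : det z v ≈ 0#
        proportional with det z v ≟ 0#
        ... | yes eq = eq
        ... | no  D≉0 = contradiction (φ-kernel v w≈0) v≉0
          where
          plücker : ∀ x y z → det z x · y ≈ⱽ det y x · z +ⱽ det y z · x
          plücker (x , x′) (y , y′) (z , z′) =
            solve 6 (λ x x′ y y′ z z′ → (z :* x′ :+ z′ :* x) :* y
              := (y :* x′ :+ y′ :* x) :* z :+ (y :* z′ :+ y′ :* z) :* x) refl x x′ y y′ z z′ ,
            solve 6 (λ x x′ y y′ z z′ → (z :* x′ :+ z′ :* x) :* y′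
              := (y :* x′ :+ y′ :* x) :* z′ :+ (y :* z′ :+ y′ :* z) :* x′) refl x x′ y y′ z z′

          T-combination : ∀ f g → T (f · z +ⱽ g · v) ≈ⱽ ω · (f · z +ⱽ g · v)
          T-combination f g = begin
            T (f · z +ⱽ g · v)             ≈⟨ φ^-+ m (f · z) (g · v) ⟩
            T (f · z) +ⱽ T (g · v)         ≈⟨ +ⱽ-cong (T-· f z) (T-· g v) ⟩
            f · T z +ⱽ g · T v             ≈⟨ +ⱽ-cong (·-cong refl Tz) (·-cong refl Tv≈ωv) ⟩
            f · ω · z +ⱽ g · ω · v         ≈⟨ row (proj₁ z) (proj₁ v) , row (proj₂ z) (proj₂ v) ⟩
            ω · (f · z +ⱽ g · v)           ∎
            where
            open ⱽ-Reasoning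
            row : ∀ x y → f * (ω * x) + g * (ω * y) ≈ ω * (f * x + g * y)
            row x y = solve 5 (λ f g ω x y → f :* (ω :* x) :+ g :* (ω :* y) := ω :* (f :* x :+ g :* y)) refl f g ω x y

          twice : det z v · (ω + 1#) · w ≈ⱽ ω · det z v · w
          twice = begin
            det z v · (ω + 1#) · w                   ≈⟨ ·-cong refl Tw ⟨
            det z v · T w                            ≈⟨ T-· (det z v) w ⟨
            T (det z v · w)                          ≈⟨ φ^-cong m (plücker v w z) ⟩
            T (det w v · z +ⱽ det w z · v)           ≈⟨ T-combination (det w v) (det w z) ⟩
            ω · (det w v · z +ⱽ det w z · v)         ≈⟨ ·-cong refl (plücker v w z) ⟨
            ω · det z v · w                          ∎
            where open ⱽ-Reasoning

          w≈0 : w ≈ⱽ 0ⱽ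
          w≈0 = ·-integral D≉0 (row (proj₁ twice) , row (proj₂ twice))
            where
            row : ∀ {x} → det z v * ((ω + 1#) * x) ≈ ω * (det z v * x) → det z v * x ≈ 0#
            row {x} eq = trans
              (solve 3 (λ D ω x → D :* x := D :* ((ω :+ con true) :* x) :+ ω :* (D :* x)) refl (det z v) ω x)
              (x≈y⇒x+y≈0 eq)

      two-cycle : 2 ∣ m → ∃ λ v → ¬ (v ≈ⱽ 0ⱽ) × det (φ (φ v)) v ≈ 0#
      two-cycle even =
        let ω , ω²+ω+1≈0   = cube-root-of-unity even
            v , v≉0 , Tv≈ωv = eigenvector ω
              (trans (+-cong (+-congˡ (trans (*-congˡ tr≈1) (*-identityʳ ω))) Δ≈1) ω²+ω+1≈0)
        in v , v≉0 , eigenlines-swapped ω²+ω+1≈0 v≉0 Tv≈ωv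

-- A criterion for EA-equivalence.

module AffineEquivalence {κ ℓ : Level} {m : ℕ} (𝕄 : FiniteField κ ℓ (2 ℕ.^ m)) where

  open FiniteField 𝕄 hiding (zero)
  open BinaryFieldProperties {m = m} 𝕄
  open Functions {m = m} 𝕄
  open Plane {m = m} 𝕄
  open Solver using (solve; _:=_; _:+_)
  open Algebra.Properties.Ring ring using (+-identityˡ-unique; +-inverseˡ-unique)
  open ⱽ-Reasoning

  -- The only scalars are 0 and 1, and negation is the identity in characteristic two.
  additive⇒linear : (f : V → V) → (∀ {v w} → v ≈ⱽ w → f v ≈ⱽ f w) →
                    (∀ v w → f (v +ⱽ w) ≈ⱽ f v +ⱽ f w) → 𝔽₂-Linear f
  additive⇒linear f f-cong f-+ = record
    { +ᴹ-isGroupHomomorphism = record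
      { isMonoidHomomorphism = record
        { isMagmaHomomorphism = record
          { isRelHomomorphism = record { cong = f-cong }
          ; homo = f-+
          }
        ; ε-homo = f-0
        }
      ; ⁻¹-homo = λ v → transⱽ (f-cong (symⱽ (v≈-v v))) (v≈-v (f v))
      }
    ; *ₗ-homo = λ { true v → reflⱽ ; false v → f-0 }
    }
    where
    x≈-x : ∀ x → x ≈ - x
    x≈-x x = +-inverseˡ-unique x x (x≈y⇒x+y≈0 refl)

    v≈-v : ∀ v → v ≈ⱽ (- proj₁ v , - proj₂ v)
    v≈-v (x , y) = x≈-x x , x≈-x y

    f-0 : f (0# , 0#) ≈ⱽ (0# , 0#)
    f-0 with f-cong {0# , 0#} (sym (+-identityʳ 0#) , sym (+-identityʳ 0#)) | f-+ (0# , 0#) (0# , 0#)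
    ... | p , q | p′ , q′ =
      +-identityˡ-unique _ _ (sym (trans p p′)) , +-identityˡ-unique _ _ (sym (trans q q′))

  -- The last premise says that (z , F z) goes to (M z , G (M z)). The affine map is block
  -- triangular, so inverses of the diagonal blocks `M` and `L` make it a permutation.
  conjugate⇒EAEquivalent : (F G M M⁻¹ N L L⁻¹ : V → V) →
    (∀ {v w} → v ≈ⱽ w → G v ≈ⱽ G w) →
    𝔽₂-Linear M → 𝔽₂-Linear N → 𝔽₂-Linear L →
    (∀ {v w} → v ≈ⱽ w → M⁻¹ v ≈ⱽ M⁻¹ w) → (∀ {v w} → v ≈ⱽ w → L⁻¹ v ≈ⱽ L⁻¹ w) →
    (∀ v → M (M⁻¹ v) ≈ⱽ v) → (∀ v → M⁻¹ (M v) ≈ⱽ v) →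
    (∀ v → L (L⁻¹ v) ≈ⱽ v) → (∀ v → L⁻¹ (L v) ≈ⱽ v) →
    (∀ v → G (M v) ≈ⱽ N v +ⱽ L (F v)) →
    EAEquivalent F G
  conjugate⇒EAEquivalent F G M M⁻¹ N L L⁻¹ G-cong M-linear N-linear L-linear
                         M⁻¹-cong L⁻¹-cong MM⁻¹ M⁻¹M LL⁻¹ L⁻¹L conjugate = record
    { M = M ; N = N ; L = L
    ; M-linear = M-linear ; N-linear = N-linear ; L-linear = L-linear
    ; u = 0ⱽ ; v = 0ⱽ
    ; permutation = injective , surjective
    ; maps-graph =
        (λ { ((x , y) , (z , x≈z , y≈Fz) , (X , Y)) → M z ,
             transⱽ (symⱽ X) (transⱽ (+ⱽ-identityʳ (M x)) (M-cong x≈z)) ,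
             transⱽ (symⱽ Y) (transⱽ (+ⱽ-identityʳ (N x +ⱽ L y))
               (transⱽ (+ⱽ-cong (N-cong x≈z) (L-cong y≈Fz)) (symⱽ (conjugate z)))) }) ,
        (λ { (z , X≈z , Y≈Gz) → (M⁻¹ z , F (M⁻¹ z)) , (M⁻¹ z , reflⱽ , reflⱽ) ,
             transⱽ (+ⱽ-identityʳ (M (M⁻¹ z))) (transⱽ (MM⁻¹ z) (symⱽ X≈z)) ,
             transⱽ (+ⱽ-identityʳ (N (M⁻¹ z) +ⱽ L (F (M⁻¹ z))))
               (transⱽ (symⱽ (conjugate (M⁻¹ z))) (transⱽ (G-cong (MM⁻¹ z)) (symⱽ Y≈Gz))) })
    }
    where
    open LeftModuleMorphisms.IsLeftModuleHomomorphism M-linear using () renaming (⟦⟧-cong to M-cong)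
    open LeftModuleMorphisms.IsLeftModuleHomomorphism N-linear using () renaming (⟦⟧-cong to N-cong)
    open LeftModuleMorphisms.IsLeftModuleHomomorphism L-linear using () renaming (⟦⟧-cong to L-cong)

    𝒜 : V × V → V × V
    𝒜 (x , y) = M x +ⱽ 0ⱽ , (N x +ⱽ L y) +ⱽ 0ⱽ

    injective : ∀ {s t} → 𝒜 s ≈² 𝒜 t → s ≈² t
    injective {x , y} {x′ , y′} (X , Y) = x≈x′ , (begin
      y              ≈⟨ L⁻¹L y ⟨
      L⁻¹ (L y)      ≈⟨ L⁻¹-cong (+ⱽ-cancelˡ (N x) (transⱽ (+ⱽ-cancelʳ 0ⱽ Y) (+ⱽ-cong (N-cong (symⱽ x≈x′)) reflⱽ))) ⟩
      L⁻¹ (L y′)     ≈⟨ L⁻¹L y′ ⟩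
      y′             ∎)
      where
      x≈x′ : x ≈ⱽ x′
      x≈x′ = begin
        x            ≈⟨ M⁻¹M x ⟨
        M⁻¹ (M x)    ≈⟨ M⁻¹-cong (+ⱽ-cancelʳ 0ⱽ X) ⟩
        M⁻¹ (M x′)   ≈⟨ M⁻¹M x′ ⟩
        x′           ∎

    surjective : ∀ t → ∃ λ s → ∀ {s′} → s′ ≈² s → 𝒜 s′ ≈² t
    -- In characteristic two, adding `n` takes away the contribution of `N`.
    surjective (x , y) = (M⁻¹ x , L⁻¹ (y +ⱽ n)) , λ { {x′ , y′} (X , Y) →
      transⱽ (+ⱽ-identityʳ (M x′)) (transⱽ (M-cong X) (MM⁻¹ x)) , (begin
        (N x′ +ⱽ L y′) +ⱽ 0ⱽ   ≈⟨ +ⱽ-identityʳ (N x′ +ⱽ L y′) ⟩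
        N x′ +ⱽ L y′           ≈⟨ +ⱽ-cong (N-cong X) (transⱽ (L-cong Y) (LL⁻¹ (y +ⱽ n))) ⟩
        n +ⱽ (y +ⱽ n)          ≈⟨ absorb _ _ , absorb _ _ ⟩
        y                      ∎) }
      where
      n : V
      n = N (M⁻¹ x)
      absorb : ∀ x y → x + (y + x) ≈ y
      absorb = solve 2 (λ x y → x :+ (y :+ x) := y) refl

-- Diagonalising the form of a Carlet function.

module Diagonalisation {κ ℓ : Level} {m : ℕ} (𝕄 : FiniteField κ ℓ (2 ℕ.^ m))
                       (even : 2 ∣ m) (C : Functions.Carlet {m = m} 𝕄) where

  open FiniteField 𝕄 hiding (zero)
  open BinaryFieldProperties {m = m} 𝕄
  open Algebra.Properties.Semiring.Exp semiring using (^-congˡ)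
  open AffineEquivalence {m = m} 𝕄
  open Functions {m = m} 𝕄
  open Carlet C using (k; 0<k; k<m; coprime; b; c; d; q; rootless)
  private instance
    m-nonZero : ℕ.NonZero m
    m-nonZero = ℕ.>-nonZero (ℕ.<-trans 0<k k<m)
  open Plane {m = m} 𝕄
  open Semilinear {m = m} 𝕄 k coprime using (σ; φ-+; φ-·; two-cycle) renaming (φ to semilinear)
  open Solver using (solve; con; _:=_; _:+_; _:*_)
  open ≈-Reasoning

  -- Group the terms of the form by their factor y or x: the cofactor of y is b x^q + d y^q, that of
  -- x is x^q + c y^q.
  φ : V → V
  φ = semilinear b d 1# c

  form≈det : ∀ v → form 1# b c d q v ≈ det (φ v) v
  form≈det (x , y) = solve 7 (λ b c d x y σx σy →
    con true :* (x :* σx) :+ b :* (σx :* y) :+ c :* (x :* σy) :+ d :* (y :* σy)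
    := (b :* σx :+ d :* σy) :* y :+ (con true :* σx :+ c :* σy) :* x) refl b c d x y (σ x) (σ y)

  -- At x = b the first two terms of the rootless polynomial cancel and b c + d remains.
  φ-regular : ¬ (b * c + d * 1# ≈ 0#)
  φ-regular singular = rootless b (trans
    (solve 4 (λ b c d σb → b :* σb :+ b :* σb :+ c :* b :+ d := b :* c :+ d :* con true) refl b c d (σ b)) singular)

  -- By homogeneity, a zero with y nonzero gives the root x / y excluded by `rootless`; for y = 0
  -- only x^(q+1) is left.
  anisotropic : ∀ v → det (φ v) v ≈ 0# → v ≈ⱽ 0ⱽ
  anisotropic v@(x , y) eq with y ≟ 0#
  ... | yes y≈0 = x≈0 , y≈0
    where
    σy≈0 : σ y ≈ 0#
    σy≈0 = trans (frob-cong k y≈0) (frob-0# k)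
    x*σx≈0 : x * σ x ≈ 0#
    x*σx≈0 = begin
      x * σ x
        ≈⟨ solve 5 (λ b c d x σx → x :* σx :=
             (b :* σx :+ d :* con false) :* con false :+ (con true :* σx :+ c :* con false) :* x) refl b c d x (σ x) ⟩
      (b * σ x + d * 0#) * 0# + (1# * σ x + c * 0#) * x
        ≈⟨ +-cong (*-cong (+-congˡ (*-congˡ σy≈0)) y≈0) (*-congʳ (+-congˡ (*-congˡ σy≈0))) ⟨
      det (φ v) v
        ≈⟨ eq ⟩
      0# ∎
    x≈0 : x ≈ 0#
    x≈0 with x ≟ 0#
    ... | yes p = p
    ... | no  p = frob-zero k (*-integral p x*σx≈0)
  ... | no  y≉0 = contradiction
    (*-integral (*-nonzero y≉0 (^-nonzero q y≉0)) (begin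
      (y * σ y) * (t * σ t + b * σ t + c * t + d)
        ≈⟨ solve 7 (λ b c d t y σt σy → (y :* σy) :* (t :* σt :+ b :* σt :+ c :* t :+ d)
             := (b :* (σt :* σy) :+ d :* σy) :* y :+ (con true :* (σt :* σy) :+ c :* σy) :* (t :* y))
             refl b c d t y (σ t) (σ y) ⟩
      (b * (σ t * σ y) + d * σ y) * y + (1# * (σ t * σ y) + c * σ y) * (t * y)
        ≈⟨ +-cong (*-congʳ (+-congʳ (*-congˡ σx))) (*-cong (+-congʳ (*-congˡ σx)) ty≈x) ⟩
      det (φ v) v
        ≈⟨ eq ⟩
      0# ∎))
    (rootless t)
    where
    t : Carrier
    t = x * inverse y y≉0
    ty≈x : t * y ≈ x
    ty≈x = trans (*-assoc x _ y) (trans (*-congˡ (inverseˡ y≉0)) (*-identityʳ x))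
    σx : σ t * σ y ≈ σ x
    σx = trans (sym (frob-* k t y)) (frob-cong k ty≈x)

  cycle : ∃ λ v → ¬ (v ≈ⱽ 0ⱽ) × det (φ (φ v)) v ≈ 0#
  cycle = two-cycle b d 1# c φ-regular anisotropic even

  module _ (v : V) (v≉0 : ¬ (v ≈ⱽ 0ⱽ)) (orthogonal : det (φ (φ v)) v ≈ 0#) where

    w : V
    w = φ v

    v₁ v₂ w₁ w₂ : Carrier
    v₁ = proj₁ v
    v₂ = proj₂ v
    w₁ = proj₁ w
    w₂ = proj₂ w

    -- These are the values of the form at v and w. As w = φ v, the value α is also the determinant
    -- of the basis, so the same α⁻¹ serves in Cramer's rule for `coordinates` and normalises both
    -- components of the function.
    α β : Carrier
    α = det w v
    β = det (φ w) w

    α≉0 : ¬ (α ≈ 0#)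
    α≉0 = v≉0 ∘ anisotropic v

    α⁻¹ : Carrier
    α⁻¹ = inverse α α≉0

    basis coordinates : V → V
    basis (X , Y) = X · v +ⱽ Y · w
    coordinates z = α⁻¹ * det z w , α⁻¹ * det z v

    det-expand : ∀ g h X Y a b a′ b′ → det (g · a +ⱽ h · b) (X · a′ +ⱽ Y · b′) ≈
                 (g * X * det a a′ + h * Y * det b b′) + (g * Y * det a b′ + h * X * det b a′)
    det-expand g h X Y (a₁ , a₂) (b₁ , b₂) (c₁ , c₂) (d₁ , d₂) =
      trans (bilinear (g * a₁) (h * b₁) (g * a₂) (h * b₂) (X * c₁) (Y * d₁) (X * c₂) (Y * d₂))
        (+-cong (+-cong (pull g X a₁ a₂ c₁ c₂) (pull h Y b₁ b₂ d₁ d₂))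
                (+-cong (pull g Y a₁ a₂ d₁ d₂) (pull h X b₁ b₂ c₁ c₂)))
      where
      bilinear : ∀ a₁ b₁ a₂ b₂ c₁ d₁ c₂ d₂ → (a₁ + b₁) * (c₂ + d₂) + (a₂ + b₂) * (c₁ + d₁) ≈
        ((a₁ * c₂ + a₂ * c₁) + (b₁ * d₂ + b₂ * d₁)) + ((a₁ * d₂ + a₂ * d₁) + (b₁ * c₂ + b₂ * c₁))
      bilinear = solve 8 (λ a₁ b₁ a₂ b₂ c₁ d₁ c₂ d₂ → (a₁ :+ b₁) :* (c₂ :+ d₂) :+ (a₂ :+ b₂) :* (c₁ :+ d₁) :=
        ((a₁ :* c₂ :+ a₂ :* c₁) :+ (b₁ :* d₂ :+ b₂ :* d₁)) :+ ((a₁ :* d₂ :+ a₂ :* d₁) :+ (b₁ :* c₂ :+ b₂ :* c₁))) refl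
      pull : ∀ g X a₁ a₂ c₁ c₂ → (g * a₁) * (X * c₂) + (g * a₂) * (X * c₁) ≈ g * X * (a₁ * c₂ + a₂ * c₁)
      pull = solve 6 (λ g X a₁ a₂ c₁ c₂ → (g :* a₁) :* (X :* c₂) :+ (g :* a₂) :* (X :* c₁)
        := g :* X :* (a₁ :* c₂ :+ a₂ :* c₁)) refl

    -- The mixed terms carry the factors [w , w] and [φ w , v]; the first vanishes identically, the
    -- second by the choice of v.
    form-diagonal : ∀ X Y → form 1# b c d q (basis (X , Y)) ≈ α * (X * σ X) + β * (Y * σ Y)
    form-diagonal X Y = begin
      form 1# b c d q z                                ≈⟨ form≈det z ⟩
      det (φ z) z                                      ≈⟨ det-cong φz (reflⱽ {z}) ⟩
      det (σ X · w +ⱽ σ Y · φ w) z                     ≈⟨ det-expand (σ X) (σ Y) X Y w (φ w) v w ⟩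
      (σ X * X * α + σ Y * Y * β) + (σ X * Y * det w w + σ Y * X * det (φ w) v)
                                                       ≈⟨ +-congˡ (+-cong (*-congˡ (det-self w)) (*-congˡ orthogonal)) ⟩
      (σ X * X * α + σ Y * Y * β) + (σ X * Y * 0# + σ Y * X * 0#)
                                                       ≈⟨ solve 6 (λ α β X Y σX σY →
                                                            (σX :* X :* α :+ σY :* Y :* β) :+ (σX :* Y :* con false :+ σY :* X :* con false)
                                                            := α :* (X :* σX) :+ β :* (Y :* σY)) refl α β X Y (σ X) (σ Y) ⟩
      α * (X * σ X) + β * (Y * σ Y)                    ∎
      where
      z : V
      z = basis (X , Y)
      φz : φ z ≈ⱽ σ X · w +ⱽ σ Y · φ w
      φz = transⱽ (φ-+ b d 1# c (X · v) (Y · w)) (+ⱽ-cong (φ-· b d 1# c X v) (φ-· b d 1# c Y w))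

    δ : Carrier
    δ = α⁻¹ * β

    αδ≈β : α * δ ≈ β
    αδ≈β = trans (sym (*-assoc α α⁻¹ β)) (trans (*-congʳ (inverseʳ α≉0)) (*-identityˡ β))

    -- If δ = a^(q+1), the form vanishes at a v + w, so this vector is zero, and pairing it with v
    -- gives α = 0. As k is odd, the (q+1)-th powers are the cubes, whence the name.
    δ-noncube : ∀ a → ¬ (δ ≈ a * σ a)
    δ-noncube a eq = α≉0 (begin
      α                     ≈⟨ solve 5 (λ a v₁ v₂ w₁ w₂ → w₁ :* v₂ :+ w₂ :* v₁
                                 := (a :* v₁ :+ con true :* w₁) :* v₂ :+ (a :* v₂ :+ con true :* w₂) :* v₁) refl a v₁ v₂ w₁ w₂ ⟩
      det (basis (a , 1#)) v ≈⟨ det-cong isotropic (reflⱽ {v}) ⟩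
      det 0ⱽ v              ≈⟨ solve 2 (λ v₁ v₂ → con false :* v₂ :+ con false :* v₁ := con false) refl v₁ v₂ ⟩
      0#                    ∎)
      where
      isotropic : basis (a , 1#) ≈ⱽ 0ⱽ
      isotropic = anisotropic (basis (a , 1#)) (begin
        det (φ (basis (a , 1#))) (basis (a , 1#))    ≈⟨ form≈det (basis (a , 1#)) ⟨
        form 1# b c d q (basis (a , 1#))             ≈⟨ form-diagonal a 1# ⟩
        α * (a * σ a) + β * (1# * σ 1#)              ≈⟨ +-cong (*-congˡ (sym eq)) (*-congˡ (trans (*-identityˡ _) (frob-1# k))) ⟩
        α * δ + β * 1#                               ≈⟨ x≈y⇒x+y≈0 (trans αδ≈β (sym (*-identityʳ β))) ⟩
        0#                                           ∎)

    zhouPott : ZhouPott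
    zhouPott = record
      { m-even = even ; k = k ; 0<k = 0<k ; k<m = k<m ; coprime = coprime
      ; j = 0 ; j<m = ℕ.<-trans 0<k k<m
      ; d = δ
      -- For j = 0 the exponent 1 - r is 0, so `zpow` evaluates to 1 and the forbidden values are
      -- the (q+1)-th powers.
      ; d-avoids = λ a b _ eq → δ-noncube a (trans eq (*-identityʳ _))
      }

    equivalent : EAEquivalent (Carlet.function C) (ZhouPott.function zhouPott)
    equivalent = conjugate⇒EAEquivalent (Carlet.function C) G coordinates basis N L L⁻¹
      G-cong
      (additive⇒linear coordinates coordinates-cong coordinates-+)
      (additive⇒linear N
        (λ eq → squares-cong (coordinates-cong eq))
        (λ z z′ → transⱽ (squares-cong (coordinates-+ z z′)) (squares-+ (coordinates z) (coordinates z′))))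
      (additive⇒linear L
        (λ { (p , q) → *-congˡ q , *-congˡ p })
        (λ { (x , y) (x′ , y′) → distribˡ α⁻¹ y y′ , distribˡ α⁻¹ x x′ }))
      (λ { (p , q) → +ⱽ-cong (·-cong p reflⱽ) (·-cong q reflⱽ) })
      (λ { (p , q) → *-congˡ q , *-congˡ p })
      coordinates-basis basis-coordinates
      (λ { (x , y) → α⁻¹α x , α⁻¹α y })
      (λ { (x , y) → αα⁻¹ x , αα⁻¹ y })
      conjugate
      where
      G : V → V
      G = ZhouPott.function zhouPott

      -- `L` exchanges the components because the product of the coordinates comes first in a Carlet
      -- function and second in a Zhou-Pott function. Hence the square terms of that product go into
      -- the second component of `N`.
      squares N L L⁻¹ : V → V
      squares (X , Y) = 0# , α⁻¹ * ((v₁ * v₂) * (X * X) + (w₁ * w₂) * (Y * Y))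
      N z = squares (coordinates z)
      L (x , y) = α⁻¹ * y , α⁻¹ * x
      L⁻¹ (x , y) = α * y , α * x

      α⁻¹α : ∀ x → α⁻¹ * (α * x) ≈ x
      α⁻¹α x = trans (sym (*-assoc α⁻¹ α x)) (trans (*-congʳ (inverseˡ α≉0)) (*-identityˡ x))

      αα⁻¹ : ∀ x → α * (α⁻¹ * x) ≈ x
      αα⁻¹ x = trans (sym (*-assoc α α⁻¹ x)) (trans (*-congʳ (inverseʳ α≉0)) (*-identityˡ x))

      form-cong : ∀ a b c d n {z z′} → z ≈ⱽ z′ → form a b c d n z ≈ form a b c d n z′
      form-cong a b c d n (p , q) =
        +-cong (+-cong (+-cong (*-congˡ (^-congˡ (suc n) p)) (*-congˡ (*-cong (^-congˡ n p) q)))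
                       (*-congˡ (*-cong p (^-congˡ n q)))) (*-congˡ (^-congˡ (suc n) q))

      G-cong : ∀ {z z′} → z ≈ⱽ z′ → G z ≈ⱽ G z′
      G-cong eq = form-cong 1# 0# 0# δ q eq , form-cong 0# 0# 1# 0# 1 eq

      coordinates-cong : ∀ {z z′} → z ≈ⱽ z′ → coordinates z ≈ⱽ coordinates z′
      coordinates-cong eq = *-congˡ (det-cong eq (reflⱽ {w})) , *-congˡ (det-cong eq (reflⱽ {v}))

      coordinates-+ : ∀ z z′ → coordinates (z +ⱽ z′) ≈ⱽ coordinates z +ⱽ coordinates z′
      coordinates-+ (x , y) (x′ , y′) = row w₁ w₂ , row v₁ v₂
        where
        row : ∀ u₁ u₂ → α⁻¹ * ((x + x′) * u₂ + (y + y′) * u₁) ≈ α⁻¹ * (x * u₂ + y * u₁) + α⁻¹ * (x′ * u₂ + y′ * u₁)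
        row u₁ u₂ = solve 7 (λ i x x′ y y′ u₁ u₂ → i :* ((x :+ x′) :* u₂ :+ (y :+ y′) :* u₁)
          := i :* (x :* u₂ :+ y :* u₁) :+ i :* (x′ :* u₂ :+ y′ :* u₁)) refl α⁻¹ x x′ y y′ u₁ u₂

      squares-cong : ∀ {z z′} → z ≈ⱽ z′ → squares z ≈ⱽ squares z′
      squares-cong (p , q) = refl , *-congˡ (+-cong (*-congˡ (*-cong p p)) (*-congˡ (*-cong q q)))

      squares-+ : ∀ z z′ → squares (z +ⱽ z′) ≈ⱽ squares z +ⱽ squares z′
      squares-+ (x , y) (x′ , y′) = sym (+-identityˡ 0#) ,
        solve 7 (λ i g h x x′ y y′ → i :* (g :* ((x :+ x′) :* (x :+ x′)) :+ h :* ((y :+ y′) :* (y :+ y′)))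
          := i :* (g :* (x :* x) :+ h :* (y :* y)) :+ i :* (g :* (x′ :* x′) :+ h :* (y′ :* y′)))
          refl α⁻¹ (v₁ * v₂) (w₁ * w₂) x x′ y y′

      coordinates-basis : ∀ z → coordinates (basis z) ≈ⱽ z
      coordinates-basis (X , Y) =
        trans (*-congˡ (solve 6 (λ X Y v₁ v₂ w₁ w₂ →
          (X :* v₁ :+ Y :* w₁) :* w₂ :+ (X :* v₂ :+ Y :* w₂) :* w₁ := (w₁ :* v₂ :+ w₂ :* v₁) :* X)
          refl X Y v₁ v₂ w₁ w₂)) (α⁻¹α X) ,
        trans (*-congˡ (solve 6 (λ X Y v₁ v₂ w₁ w₂ →
          (X :* v₁ :+ Y :* w₁) :* v₂ :+ (X :* v₂ :+ Y :* w₂) :* v₁ := (w₁ :* v₂ :+ w₂ :* v₁) :* Y)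
          refl X Y v₁ v₂ w₁ w₂)) (α⁻¹α Y)

      basis-coordinates : ∀ z → basis (coordinates z) ≈ⱽ z
      basis-coordinates (x , y) =
        trans (solve 7 (λ i x y v₁ v₂ w₁ w₂ →
          (i :* (x :* w₂ :+ y :* w₁)) :* v₁ :+ (i :* (x :* v₂ :+ y :* v₁)) :* w₁ := i :* ((w₁ :* v₂ :+ w₂ :* v₁) :* x))
          refl α⁻¹ x y v₁ v₂ w₁ w₂) (α⁻¹α x) ,
        trans (solve 7 (λ i x y v₁ v₂ w₁ w₂ →
          (i :* (x :* w₂ :+ y :* w₁)) :* v₂ :+ (i :* (x :* v₂ :+ y :* v₁)) :* w₂ := i :* ((w₁ :* v₂ :+ w₂ :* v₁) :* y))
          refl α⁻¹ x y v₁ v₂ w₁ w₂) (α⁻¹α y)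

      function-basis : ∀ X Y → G (X , Y) ≈ⱽ squares (X , Y) +ⱽ L (Carlet.function C (basis (X , Y)))
      function-basis X Y =
        (begin
          form 1# 0# 0# δ q (X , Y)
            ≈⟨ solve 5 (λ δ X Y σX σY → con true :* (X :* σX) :+ con false :* (σX :* Y) :+ con false :* (X :* σY) :+ δ :* (Y :* σY)
                 := X :* σX :+ δ :* (Y :* σY)) refl δ X Y (σ X) (σ Y) ⟩
          X * σ X + δ * (Y * σ Y)
            ≈⟨ +-cong (α⁻¹α (X * σ X)) (sym (*-assoc α⁻¹ β (Y * σ Y))) ⟨
          α⁻¹ * (α * (X * σ X)) + α⁻¹ * (β * (Y * σ Y))
            ≈⟨ distribˡ α⁻¹ _ _ ⟨
          α⁻¹ * (α * (X * σ X) + β * (Y * σ Y))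
            ≈⟨ *-congˡ (form-diagonal X Y) ⟨
          α⁻¹ * form 1# b c d q (basis (X , Y))
            ≈⟨ +-identityˡ _ ⟨
          0# + α⁻¹ * form 1# b c d q (basis (X , Y)) ∎) ,
        (begin
          form 0# 0# 1# 0# 1 (X , Y)
            ≈⟨ solve 2 (λ X Y → con false :* (X :* (X :* con true)) :+ con false :* ((X :* con true) :* Y)
                 :+ con true :* (X :* (Y :* con true)) :+ con false :* (Y :* (Y :* con true)) := X :* Y) refl X Y ⟩
          X * Y
            ≈⟨ α⁻¹α (X * Y) ⟨
          α⁻¹ * (α * (X * Y))
            ≈⟨ solve 7 (λ i X Y v₁ v₂ w₁ w₂ → i :* ((w₁ :* v₂ :+ w₂ :* v₁) :* (X :* Y))
                 := i :* ((v₁ :* v₂) :* (X :* X) :+ (w₁ :* w₂) :* (Y :* Y))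
                    :+ i :* ((X :* v₁ :+ Y :* w₁) :* (X :* v₂ :+ Y :* w₂))) refl α⁻¹ X Y v₁ v₂ w₁ w₂ ⟩
          proj₂ (squares (X , Y) +ⱽ L (Carlet.function C (basis (X , Y)))) ∎)

      conjugate : ∀ z → G (coordinates z) ≈ⱽ N z +ⱽ L (Carlet.function C z)
      conjugate z = transⱽ (function-basis _ _) (+ⱽ-cong (reflⱽ {N z})
        ( *-congˡ (form-cong 1# b c d q (basis-coordinates z))
        , *-congˡ (*-cong (proj₁ (basis-coordinates z)) (proj₂ (basis-coordinates z)))))

open import Data.Nat using (ℕ; _^_)

theoremB3 : ∀ {κ ℓ : Level} (m : ℕ) (𝕄 : FiniteField κ ℓ (2 ^ m)) →
    2 ∣ m →
    let open Functions {κ} {ℓ} {m} 𝕄 in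
    (C : Carlet) →
    ∃ λ (Z : ZhouPott) →
    EAEquivalent (Carlet.function C) (ZhouPott.function Z)
theoremB3 m 𝕄 even C =
  let v , v≉0 , orthogonal = cycle in zhouPott v v≉0 orthogonal , equivalent v v≉0 orthogonal
  where open Diagonalisation {m = m} 𝕄 even C
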